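{- None of the following four topological spaces is definable in any o-minimal structure, i.e. for each of them, there is no o-minimal structure $M$ and no topological space definable in $M$ that is homeomorphic to it: (1) the Arens space; (2) the maximal compact topology; (3) the one point compactification of the rationals; (4) the Appert space.
   Context: O-minimality is understood in the sense of van den Dries' book "Tame Topology and O-minimal Structures": $M$ is an expansion of a dense linear order $(M,<)$ without endpoints such that every subset of $M$ definable with parameters is a finite union of points and open intervals with endpoints in $M\cup\{ -\infty,+\infty\}$. "Definable" means definable in $M$, possibly with parameters from $M$. A topological space $(A,\tau)$ is definable in $M$ when $A\subseteq M^n$ (for some $n$) is a definable set and there exists a definable basis for the topology $\tau$, i.e. a basis of the form $\{\varphi(A;b) : b\in B\}$ for some formula $\varphi(x;y)$ with $|x|=n$ and some definable set $B\subseteq M^{|y|}$, where $\varphi(A;b)=\{a\in A : M\models\varphi(a;b)\}$. The four (countable) spaces are the following. Arens space: the underlying set consists of distinct points $\infty$, $x_n$ ($n\in\mathbb{N}$) and $x_{n,m}$ ($n,m\in\mathbb{N}$). A set $U$ is open if and only if: whenever $\infty\in U$, then $x_n\in U$ for all but finitely many $n$; and, for every $n$, whenever $x_n\in U$, then $x_{n,m}\in U$ for all but finitely many $m$. Maximal compact topology: the underlying set is $X=(\mathbb{Z}_{>0}\times\mathbb{Z}_{>0})\cup\{x,y\}$ with $x\neq y$ two additional points. Each point of $\mathbb{Z}_{>0}\times\mathbb{Z}_{>0}$ is isolated; the basic open neighborhoods of $x$ are the sets $X\setminus(\{y\}\cup P)$ where $P\subseteq \mathbb{Z}_{>0}\times\mathbb{Z}_{>0}$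 contains at most finitely many points of each row; the basic open neighborhoods of $y$ are the sets $X\setminus(\{x\}\cup Q)$ where $Q\subseteq\mathbb{Z}_{>0}\times\mathbb{Z}_{>0}$ is contained in a union of finitely many rows. (A row is a set of the form $\mathbb{Z}_{>0}\times\{j\}$.) One point compactification of the rationals: the underlying set is $\mathbb{Q}\cup\{\infty\}$; the open sets are the open subsets of $\mathbb{Q}$ (with the usual Euclidean topology) together with the sets $(\mathbb{Q}\setminus K)\cup\{\infty\}$ with $K\subseteq\mathbb{Q}$ compact. Appert space: the underlying set is $\mathbb{Z}_{>0}$; for $E\subseteq\mathbb{Z}_{>0}$ let $N(n,E)=|\{m\in E : m\leq n\}|$. A set $E$ is open if and only if either $1\notin E$, or $1\in E$ and $\lim_{n\to\infty} N(n,E)/n=1$. -}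

module Defs where

import Algebra.Properties.AbelianGroup as AbelianGroupProperties
import Algebra.Properties.Group as GroupProperties
open import Axiom.ExcludedMiddle using (ExcludedMiddle)
open import Data.Empty using (⊥-elim)
import Data.Empty.Polymorphic as Poly
open import Data.Fin.Base using (Fin)
import Data.Integer.Base as ℤ
import Data.Integer.Properties as ℤ
open import Data.List.Base using (List; []; _∷_; _++_; mapMaybe; filter; length; applyUpTo)
open import Data.List.Membership.Propositional using () renaming (_∈_ to _∈ˡ_)
open import Data.List.Membership.Propositional.Properties using (∈-++⁺ˡ; ∈-++⁺ʳ)
import Data.List.Membership.DecPropositional as DecMembership
open import Data.List.Properties using (length-applyUpTo; length-filter; filter-all)
import Data.List.Relation.Unary.All as All
open import Data.List.Relation.Unary.Any using (Any; here; there)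
import Data.List.Relation.Unary.Any.Properties as Any
open import Data.Maybe.Base using (Maybe; just; nothing)
open import Data.Nat.Base as ℕ using (ℕ; zero; suc; NonZero)
import Data.Nat.Properties as ℕ
open import Data.Nat.Solver using (module +-*-Solver)
open import Data.Product using (_×_; _,_; proj₁; proj₂; ∃-syntax; Σ-syntax)
open import Data.Rational as ℚ using (ℚ; 0ℚ; 1ℚ; ½)
import Data.Rational.Properties as ℚ
import Data.Rational.Unnormalised.Base as ℚᵘ
import Data.Rational.Unnormalised.Properties as ℚᵘ
open import Data.Refinement using (value; Refinement-syntax)
open import Data.Sum using (_⊎_; inj₁; inj₂; [_,_]′)
open import Data.Unit.Polymorphic using (tt)
open import Data.Vec.Base as Vec using (Vec; []; _∷_; lookup; head)
open import Function.Base using (_∘_; id; _$_)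
open import Function.Bundles using (_↔_; Inverse)
open import Level using (Level; 0ℓ; _⊔_; Lift; lift) renaming (suc to lsuc)
import Relation.Binary.Core as Binary
open import Relation.Binary.Definitions using (_Respects_)
open import Relation.Binary.PropositionalEquality using (_≡_; _≢_; refl; sym; trans; cong; cong₂;
  subst; subst₂; module ≡-Reasoning)
open import Relation.Binary.Structures using (IsDenseLinearOrder)
import Relation.Binary.Construct.Add.Extrema.Strict as Extrema
open import Relation.Nullary using (¬_; yes; no; contradiction)
open import Relation.Nullary.Construct.Add.Extrema using (_±; [_])
open import Relation.Unary using (Pred; _∈_; _∉_; _⊆_; _≐_; _∩_; _∪_; ∁; ⋃; _⊢_; ｛_｝)
open import Relation.Unary.Polymorphic using (∅; U)

private variable
  a b f i o o′ p r ℓ : Level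
  X : Set a
  Y : Set b

------------------------------------------------------------------------
-- First-order logic

record Language (f r : Level) : Set (lsuc (f ⊔ r)) where
  field
    Fun : ℕ → Set f
    Rel : ℕ → Set r

data Term (L : Language f r) (n : ℕ) : Set f where
  var : Fin n → Term L n
  fun : ∀ {k} → Language.Fun L k → Vec (Term L n) k → Term L n

-- Formulas in the language L extended by a binary symbol ≺ for the
-- order.  A formula in Formula L n has its free variables among n
-- (de Bruijn indexed) variables.
data Formula (L : Language f r) (n : ℕ) : Set (f ⊔ r) where
  _≋_ _≺_     : Term L n → Term L n → Formula L n
  rel         : ∀ {k} → Language.Rel L k → Vec (Term L n) k → Formula L n
  ⊥̇           : Formula L n
  _∧̇_ _∨̇_ _⇒̇_ : Formula L n → Formula L n → Formula L n
  ∀̇_ ∃̇_       : Formula L (suc n) → Formula L n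

record Structure (L : Language f r) (ℓ : Level) : Set (f ⊔ r ⊔ lsuc ℓ) where
  infix 4 _<_
  field
    Carrier : Set ℓ
    _<_     : Binary.Rel Carrier ℓ
    ⟦fun⟧   : ∀ {k} → Language.Fun L k → Vec Carrier k → Carrier
    ⟦rel⟧   : ∀ {k} → Language.Rel L k → Pred (Vec Carrier k) ℓ

module _ {L : Language f r} (M : Structure L ℓ) where
  open Structure M

  mutual
    ⟦_⟧ : ∀ {n} → Term L n → Vec Carrier n → Carrier
    ⟦ var i ⟧    v = lookup v i
    ⟦ fun g ts ⟧ v = ⟦fun⟧ g (⟦ ts ⟧* v)

    ⟦_⟧* : ∀ {n k} → Vec (Term L n) k → Vec Carrier n → Vec Carrier k
    ⟦ [] ⟧*     v = []
    ⟦ t ∷ ts ⟧* v = ⟦ t ⟧ v ∷ ⟦ ts ⟧* v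

infix 3 _⊨_[_]
_⊨_[_] : {L : Language f r} (M : Structure L ℓ) {n : ℕ} →
         Formula L n → Vec (Structure.Carrier M) n → Set ℓ
M ⊨ (s ≋ t)    [ v ] = ⟦_⟧ M s v ≡ ⟦_⟧ M t v
M ⊨ (s ≺ t)    [ v ] = Structure._<_ M (⟦_⟧ M s v) (⟦_⟧ M t v)
M ⊨ (rel R ts) [ v ] = Structure.⟦rel⟧ M R (⟦_⟧* M ts v)
M ⊨ ⊥̇          [ v ] = Poly.⊥
M ⊨ (φ ∧̇ ψ)    [ v ] = (M ⊨ φ [ v ]) × (M ⊨ ψ [ v ])
M ⊨ (φ ∨̇ ψ)    [ v ] = (M ⊨ φ [ v ]) ⊎ (M ⊨ ψ [ v ])
M ⊨ (φ ⇒̇ ψ)    [ v ] = M ⊨ φ [ v ] → M ⊨ ψ [ v ]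
M ⊨ (∀̇ φ)      [ v ] = ∀ c → M ⊨ φ [ c ∷ v ]
M ⊨ (∃̇ φ)      [ v ] = ∃[ c ] M ⊨ φ [ c ∷ v ]

module _ {L : Language f r} (M : Structure L ℓ) where
  open Structure M

  -- Definable with parameters c.
  Definable : ∀ {n} → Pred (Vec Carrier n) ℓ → Set (f ⊔ r ⊔ ℓ)
  Definable {n} S = ∃[ m ] Σ[ φ ∈ Formula L (n ℕ.+ m) ] Σ[ c ∈ Vec Carrier m ]
    (S ≐ λ v → M ⊨ φ [ v Vec.++ c ])

  open Extrema _<_ using (_<±_)

  data Piece : Set ℓ where
    point    : Carrier → Piece
    interval : (a b : Carrier ±) → Piece

  _∈ᵖ_ : Carrier → Piece → Set ℓ
  c ∈ᵖ point a      = c ≡ a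
  c ∈ᵖ interval a b = a <± [ c ] × [ c ] <± b

  record OMinimal : Set (f ⊔ r ⊔ lsuc ℓ) where
    field
      isDenseLinearOrder : IsDenseLinearOrder _≡_ _<_
      noMinimum          : ∀ c → ∃[ d ] d < c
      noMaximum          : ∀ c → ∃[ d ] c < d
      tame               : (S : Pred Carrier ℓ) → Definable {n = 1} (head ⊢ S) →
                           ∃[ ps ] (S ≐ λ c → Any (c ∈ᵖ_) ps)

------------------------------------------------------------------------
-- Topology

-- Collections of open sets are indexed by small types; under excluded
-- middle every subset has a Bool-valued characteristic function, so for
-- a ≤ p this is no restriction.
record Topology (X : Set a) (p o : Level) : Set (a ⊔ lsuc (p ⊔ o)) where
  field
    Open      : Pred (Pred X p) o
    Open-resp : Open Respects _≐_
    ∅-open    : ∅ ∈ Open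
    U-open    : U ∈ Open
    ∩-open    : ∀ {V W} → V ∈ Open → W ∈ Open → V ∩ W ∈ Open
    ⋃-open    : ∀ {I : Set p} {V : I → Pred X p} → (∀ j → V j ∈ Open) → ⋃ I V ∈ Open

open Topology using (Open)

Continuous : Topology X p o → Topology Y p o′ → (X → Y) → Set _
Continuous σ τ g = ∀ {V} → V ∈ Open τ → g ⊢ V ∈ Open σ

infix 4 _≃ₜ_
record _≃ₜ_ {X : Set a} {Y : Set b} (σ : Topology X p o) (τ : Topology Y p o′)
       : Set (a ⊔ b ⊔ lsuc p ⊔ o ⊔ o′) where
  field
    bijection       : X ↔ Y
    to-continuous   : Continuous σ τ (Inverse.to bijection)
    from-continuous : Continuous τ σ (Inverse.from bijection)

IsBasis : Topology X p o → {I : Set i} → (I → Pred X p) → Set _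
IsBasis τ B = (∀ j → B j ∈ Open τ) ×
              (∀ {V} → V ∈ Open τ → ∀ {x} → x ∈ V → ∃[ j ] x ∈ B j × B j ⊆ V)

Compact : Topology X p o → Pred X p → Set _
Compact {X = X} {p = p} τ K =
  ∀ {I : Set p} (V : I → Pred X p) → (∀ j → V j ∈ Open τ) → K ⊆ ⋃ I V →
  Σ[ js ∈ List I ] K ⊆ λ x → Any (λ j → x ∈ V j) js

-- The subset A of Mⁿ is the type [ a ∈ Mⁿ ∣ A a ], in which membership
-- proofs are irrelevant, so that points are equal when their coordinates are.
record IsDefinableSpace {L : Language f r} (M : Structure L ℓ) {n : ℕ}
         (A : Pred (Vec (Structure.Carrier M) n) ℓ)
         (τ : Topology [ v ∈ Vec (Structure.Carrier M) n ∣ A v ] ℓ o)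
         : Set (f ⊔ r ⊔ lsuc ℓ ⊔ o) where
  open Structure M
  field
    A-definable : Definable M A
    {k}         : ℕ
    φ           : Formula L (n ℕ.+ k)
    B           : Pred (Vec Carrier k) ℓ
    B-definable : Definable M B
    isBasis     : IsBasis τ {I = Σ[ b ∈ Vec Carrier k ] b ∈ B}
                    (λ (b , _) v → M ⊨ φ [ value v Vec.++ b ])

------------------------------------------------------------------------
-- Finiteness

Finite : Pred X p → Set _
Finite P = ∃[ xs ] P ⊆ (_∈ˡ xs)

private
  cofinite-∩ : {P Q : Pred ℕ p} → Finite (∁ P) → Finite (∁ Q) → Finite (∁ (P ∩ Q))
  cofinite-∩ {P = P} {Q} (xs , P⊆) (ys , Q⊆) = xs ++ ys , λ {n} → go n
    where
    open DecMembership ℕ._≟_ using (_∈?_)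
    go : ∀ n → n ∉ P ∩ Q → n ∈ˡ xs ++ ys
    go n n∉ with n ∈? (xs ++ ys)
    ... | yes n∈ = n∈
    ... | no ¬n∈ = ⊥-elim (¬n∈ (∈-++⁺ˡ (P⊆ λ n∈P →
                     ¬n∈ (∈-++⁺ʳ xs (Q⊆ λ n∈Q → n∉ (n∈P , n∈Q))))))

  finite-⊆ : {P : Pred X p} {Q : Pred X o} → Q ⊆ P → Finite P → Finite Q
  finite-⊆ Q⊆P (xs , P⊆) = xs , P⊆ ∘ Q⊆P

------------------------------------------------------------------------
-- The Arens space

data ArensPoint : Set where
  ∞  : ArensPoint
  x₁ : ℕ → ArensPoint
  x₂ : ℕ → ℕ → ArensPoint

arens : ∀ p → Topology ArensPoint p p
arens p = record
  { Open      = IsOpen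
  ; Open-resp = λ { (V⊆W , W⊆V) (at∞ , at₁) →
      (λ ∞∈ → finite-⊆ (_∘ V⊆W) (at∞ (W⊆V ∞∈))) ,
      (λ n x∈ → finite-⊆ (_∘ V⊆W) (at₁ n (W⊆V x∈))) }
  ; ∅-open    = (λ ()) , (λ _ ())
  ; U-open    = (λ _ → [] , λ ∉U → ⊥-elim (∉U tt)) , (λ _ _ → [] , λ ∉U → ⊥-elim (∉U tt))
  ; ∩-open    = λ (V∞ , V₁) (W∞ , W₁) →
      (λ (∞∈V , ∞∈W) → cofinite-∩ (V∞ ∞∈V) (W∞ ∞∈W)) ,
      (λ n (x∈V , x∈W) → cofinite-∩ (V₁ n x∈V) (W₁ n x∈W))
  ; ⋃-open    = λ V-open →
      (λ (j , ∞∈) → finite-⊆ (_∘ (j ,_)) (proj₁ (V-open j) ∞∈)) ,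
      (λ n (j , x∈) → finite-⊆ (_∘ (j ,_)) (proj₂ (V-open j) n x∈))
  }
  where
  IsOpen : Pred (Pred ArensPoint p) p
  IsOpen V = (∞ ∈ V → Finite (λ n → x₁ n ∉ V)) ×
             (∀ n → x₁ n ∈ V → Finite (λ m → x₂ n m ∉ V))

------------------------------------------------------------------------
-- The maximal compact topology

record ℕ⁺ : Set where
  constructor 1+_
  field pred : ℕ

data MaximalCompactPoint : Set where
  pt  : ℕ⁺ × ℕ⁺ → MaximalCompactPoint
  x y : MaximalCompactPoint

-- The set {z} ∪ P.
data AddPoint (z : MaximalCompactPoint) (P : Pred (ℕ⁺ × ℕ⁺) p) : Pred MaximalCompactPoint p where
  extra : z ∈ AddPoint z P
  grid  : ∀ {q} → q ∈ P → pt q ∈ AddPoint z P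

private
  AddPoint-mono : ∀ {z} {P Q : Pred (ℕ⁺ × ℕ⁺) p} → P ⊆ Q → AddPoint z P ⊆ AddPoint z Q
  AddPoint-mono P⊆Q extra      = extra
  AddPoint-mono P⊆Q (grid q∈P) = grid (P⊆Q q∈P)

  finite-∪ : {P Q : Pred X p} → Finite P → Finite Q → Finite (P ∪ Q)
  finite-∪ (xs , P⊆) (ys , Q⊆) = xs ++ ys , [ ∈-++⁺ˡ ∘ P⊆ , ∈-++⁺ʳ xs ∘ Q⊆ ]′

maximalCompact : ∀ p → Topology MaximalCompactPoint p (lsuc p)
maximalCompact p = record
  { Open      = λ V → ∀ z → z ∈ V → z HasNbhdIn V
  ; Open-resp = λ (V⊆W , W⊆V) V-open z z∈W → mono z V⊆W (V-open z (W⊆V z∈W))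
  ; ∅-open    = λ _ ()
  ; U-open    = λ where
      (pt _) _ → lift λ _ → tt
      x      _ → ∅ , (λ _ → [] , λ ()) , λ _ → tt
      y      _ → ∅ , ([] , λ ()) , λ _ → tt
  ; ∩-open    = λ V-open W-open z (z∈V , z∈W) → meet z (V-open z z∈V) (W-open z z∈W)
  ; ⋃-open    = λ V-open z (j , z∈V) → mono z (j ,_) (V-open j z z∈V)
  }
  where
  -- Some basic open neighbourhood of z is contained in V.  The row with
  -- index j is {(m , j) ∣ m ∈ ℕ⁺}.
  _HasNbhdIn_ : MaximalCompactPoint → Pred MaximalCompactPoint p → Set (lsuc p)
  pt q HasNbhdIn V = Lift (lsuc p) (｛ pt q ｝ ⊆ V)
  x    HasNbhdIn V = Σ[ P ∈ Pred (ℕ⁺ × ℕ⁺) p ]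
    (∀ j → Finite (λ m → (m , j) ∈ P)) × ∁ (AddPoint y P) ⊆ V
  y    HasNbhdIn V = Σ[ Q ∈ Pred (ℕ⁺ × ℕ⁺) p ]
    (∃[ js ] ∀ {m j} → (m , j) ∈ Q → j ∈ˡ js) × ∁ (AddPoint x Q) ⊆ V

  mono : ∀ z {V W} → V ⊆ W → z HasNbhdIn V → z HasNbhdIn W
  mono (pt q) V⊆W (lift q⊆V)       = lift λ z∈ → V⊆W (q⊆V z∈)
  mono x      V⊆W (P , fin , ⊆V)  = P , fin , λ z∈ → V⊆W (⊆V z∈)
  mono y      V⊆W (Q , rows , ⊆V) = Q , rows , λ z∈ → V⊆W (⊆V z∈)

  meet : ∀ z {V W} → z HasNbhdIn V → z HasNbhdIn W → z HasNbhdIn (V ∩ W)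
  meet (pt q) (lift q⊆V) (lift q⊆W) = lift λ z∈ → q⊆V z∈ , q⊆W z∈
  meet x (P , fin , ⊆V) (P′ , fin′ , ⊆W) =
    P ∪ P′ , (λ j → finite-∪ (fin j) (fin′ j)) ,
    λ z∉ → ⊆V (z∉ ∘ AddPoint-mono inj₁) , ⊆W (z∉ ∘ AddPoint-mono inj₂)
  meet y (Q , (js , rows) , ⊆V) (Q′ , (js′ , rows′) , ⊆W) =
    Q ∪ Q′ , (js ++ js′ , [ ∈-++⁺ˡ ∘ rows , ∈-++⁺ʳ js ∘ rows′ ]′) ,
    λ z∉ → ⊆V (z∉ ∘ AddPoint-mono inj₁) , ⊆W (z∉ ∘ AddPoint-mono inj₂)

------------------------------------------------------------------------
-- The one-point compactification of ℚ

private
  0<⊓ : ∀ {ε δ} → 0ℚ ℚ.< ε → 0ℚ ℚ.< δ → 0ℚ ℚ.< ε ℚ.⊓ δ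
  0<⊓ {ε} {δ} 0<ε 0<δ with ℚ.⊓-sel ε δ
  ... | inj₁ eq = subst (0ℚ ℚ.<_) (sym eq) 0<ε
  ... | inj₂ eq = subst (0ℚ ℚ.<_) (sym eq) 0<δ

euclideanℚ : ∀ p → Topology ℚ p p
euclideanℚ p = record
  { Open      = λ V → ∀ q → q ∈ V → ∃[ ε ] 0ℚ ℚ.< ε × Ball q ε ⊆ V
  ; Open-resp = λ (V⊆W , W⊆V) V-open q q∈W →
      let ε , 0<ε , ball = V-open q (W⊆V q∈W) in ε , 0<ε , λ {_} d → V⊆W (ball d)
  ; ∅-open    = λ _ ()
  ; U-open    = λ _ _ → 1ℚ , ℚ.positive⁻¹ 1ℚ , λ _ → tt
  ; ∩-open    = λ V-open W-open q (q∈V , q∈W) →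
      let ε , 0<ε , ballV = V-open q q∈V
          δ , 0<δ , ballW = W-open q q∈W
      in ε ℚ.⊓ δ , 0<⊓ 0<ε 0<δ ,
         λ {_} d → ballV (ℚ.<-≤-trans d (ℚ.p⊓q≤p ε δ)) , ballW (ℚ.<-≤-trans d (ℚ.p⊓q≤q ε δ))
  ; ⋃-open    = λ V-open q (j , q∈V) →
      let ε , 0<ε , ball = V-open j q q∈V in ε , 0<ε , λ {_} d → j , ball d
  }
  where
  Ball : ℚ → ℚ → Pred ℚ 0ℓ
  Ball q ε q′ = ℚ.∣ q′ ℚ.- q ∣ ℚ.< ε

private
  compact-∪ : (τ : Topology X p o) {K K′ : Pred X p} →
              Compact τ K → Compact τ K′ → Compact τ (K ∪ K′)
  compact-∪ τ cK cK′ V V-open cover =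
    let js  , K⊆  = cK V V-open (cover ∘ inj₁)
        js′ , K′⊆ = cK′ V V-open (cover ∘ inj₂)
    in js ++ js′ , [ Any.++⁺ˡ ∘ K⊆ , Any.++⁺ʳ js ∘ K′⊆ ]′

  compact-∖ : ExcludedMiddle p → (τ : Topology X p o) {K W : Pred X p} →
              Compact τ K → W ∈ Open τ → Compact τ (K ∩ ∁ W)
  compact-∖ {p} {X = X} em τ {K} {W} cK W-open {I} V V-open cover =
    let js , K⊆ = cK V⁺ (λ { nothing → W-open ; (just j) → V-open j }) cover⁺
    in mapMaybe id js , λ (z∈K , z∉W) → restrict z∉W js (K⊆ z∈K)
    where
    V⁺ : Maybe I → Pred X p
    V⁺ nothing  = W
    V⁺ (just j) = V j
    cover⁺ : K ⊆ ⋃ (Maybe I) V⁺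
    cover⁺ {z} z∈K with em {z ∈ W}
    ... | yes z∈W = nothing , z∈W
    ... | no  z∉W = let j , z∈V = cover (z∈K , z∉W) in just j , z∈V
    restrict : ∀ {z} → z ∉ W → ∀ js → Any (λ j → z ∈ V⁺ j) js →
               Any (λ j → z ∈ V j) (mapMaybe id js)
    restrict z∉W (nothing ∷ js) (here z∈W)  = contradiction z∈W z∉W
    restrict z∉W (nothing ∷ js) (there any) = restrict z∉W js any
    restrict z∉W (just j ∷ js)  (here z∈V)  = here z∈V
    restrict z∉W (just j ∷ js)  (there any) = there (restrict z∉W js any)

  p<q⇒0<q-p : ∀ {s t} → s ℚ.< t → 0ℚ ℚ.< t ℚ.- s
  p<q⇒0<q-p {s} {t} s<t = subst (ℚ._< t ℚ.- s) (ℚ.+-inverseʳ s) (ℚ.+-monoˡ-< (ℚ.- s) s<t)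

  0<∣p-q∣ : ∀ {s t} → s ≢ t → 0ℚ ℚ.< ℚ.∣ s ℚ.- t ∣
  0<∣p-q∣ {s} {t} s≢t = ℚ.≰⇒> λ d≤0 →
    s≢t (x∙y⁻¹≈ε⇒x≈y s t (ℚ.∣p∣≡0⇒p≡0 (s ℚ.- t) (ℚ.≤-antisym d≤0 (ℚ.0≤∣p∣ (s ℚ.- t)))))
    where open GroupProperties ℚ.+-0-group

  p-q+q≡p : ∀ s t → (s ℚ.- t) ℚ.+ t ≡ s
  p-q+q≡p s t = GroupProperties.//-rightDividesˡ ℚ.+-0-group t s

  triangle : ∀ s t q → ℚ.∣ s ℚ.- q ∣ ℚ.≤ ℚ.∣ t ℚ.- s ∣ ℚ.+ ℚ.∣ t ℚ.- q ∣
  triangle s t q = begin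
    ℚ.∣ s ℚ.- q ∣                       ≡⟨ cong (λ u → ℚ.∣ u ℚ.- q ∣) (p-q+q≡p s t) ⟨
    ℚ.∣ (s ℚ.- t) ℚ.+ t ℚ.- q ∣         ≡⟨ cong ℚ.∣_∣ (ℚ.+-assoc (s ℚ.- t) t (ℚ.- q)) ⟩
    ℚ.∣ (s ℚ.- t) ℚ.+ (t ℚ.- q) ∣       ≤⟨ ℚ.∣p+q∣≤∣p∣+∣q∣ (s ℚ.- t) (t ℚ.- q) ⟩
    ℚ.∣ s ℚ.- t ∣ ℚ.+ ℚ.∣ t ℚ.- q ∣     ≡⟨ cong (ℚ._+ ℚ.∣ t ℚ.- q ∣) swap ⟩
    ℚ.∣ t ℚ.- s ∣ ℚ.+ ℚ.∣ t ℚ.- q ∣     ∎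
    where
    open ℚ.≤-Reasoning
    open AbelianGroupProperties ℚ.+-0-abelianGroup using (⁻¹-anti-homo‿-)
    swap : ℚ.∣ s ℚ.- t ∣ ≡ ℚ.∣ t ℚ.- s ∣
    swap = trans (sym (ℚ.∣-p∣≡∣p∣ (s ℚ.- t))) (cong ℚ.∣_∣ (⁻¹-anti-homo‿- s t))

  -- If q ∉ K then K is covered by the open sets {s ∣ ε < ∣s - q∣}, ε > 0.
  compact-closed : {K : Pred ℚ p} → Compact (euclideanℚ p) K → ∁ K ∈ Open (euclideanℚ p)
  compact-closed {p} {K} cK q q∉K =
    let js , K⊆ = cK V V-open cover
        δ , 0<δ , δ≤ = least js
    in δ , 0<δ , λ {s} d<δ s∈K → ℚ.<-irrefl refl (ℚ.<-trans d<δ (δ≤ {s} (K⊆ s∈K)))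
    where
    Radius : Set p
    Radius = Lift p (∃[ ε ] 0ℚ ℚ.< ε)
    V : Radius → Pred ℚ p
    V (lift (ε , _)) s = Lift p (ε ℚ.< ℚ.∣ s ℚ.- q ∣)
    V-open : ∀ j → V j ∈ Open (euclideanℚ p)
    V-open (lift (ε , _)) s (lift ε<d) = ℚ.∣ s ℚ.- q ∣ ℚ.- ε , p<q⇒0<q-p ε<d , λ {t} t-near →
      lift (ℚ.≰⇒> λ t≤ε → ℚ.<-irrefl refl (ℚ.≤-<-trans (triangle s t q)
        (subst (ℚ.∣ t ℚ.- s ∣ ℚ.+ ℚ.∣ t ℚ.- q ∣ ℚ.<_) (p-q+q≡p _ ε) (ℚ.+-mono-<-≤ t-near t≤ε))))
    cover : K ⊆ ⋃ Radius V
    cover {s} s∈K =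
      let ε , 0<ε , ε<d = ℚ.<-dense (0<∣p-q∣ {s} {q} λ { refl → q∉K s∈K })
      in lift (ε , 0<ε) , lift ε<d
    least : ∀ js → ∃[ δ ] 0ℚ ℚ.< δ × (∀ {s} → Any (λ j → s ∈ V j) js → δ ℚ.< ℚ.∣ s ℚ.- q ∣)
    least []                     = 1ℚ , ℚ.positive⁻¹ 1ℚ , λ ()
    least (lift (ε , 0<ε) ∷ js) =
      let δ , 0<δ , δ≤ = least js
          bound : ∀ {s} → Any (λ j → s ∈ V j) (lift (ε , 0<ε) ∷ js) → ε ℚ.⊓ δ ℚ.< ℚ.∣ s ℚ.- q ∣
          bound = λ { (here (lift ε<d)) → ℚ.≤-<-trans (ℚ.p⊓q≤p ε δ) ε<d
                    ; {s} (there any)   → ℚ.≤-<-trans (ℚ.p⊓q≤q ε δ) (δ≤ {s} any) }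
      in ε ℚ.⊓ δ , 0<⊓ 0<ε 0<δ , λ {s} → bound {s}

-- Excluded middle only serves to verify that unions of open sets are open.
ℚ∞ : (∀ {a} → ExcludedMiddle a) → ∀ p → Topology (Maybe ℚ) p (lsuc p)
ℚ∞ em p = record
  { Open      = IsOpen
  ; Open-resp = λ where
      (V⊆W , W⊆V) (inj₁ (∞∉V , V-open)) →
        inj₁ ((∞∉V ∘ W⊆V) , Open-resp ((λ {z} → V⊆W {just z}) , λ {z} → W⊆V {just z}) V-open)
      (V⊆W , W⊆V) (inj₂ (∞∈V , K , cK , V⊆ , ⊆V)) →
        inj₂ (V⊆W ∞∈V , K , cK , (λ z∈ → V⊆ (W⊆V z∈)) , λ z∉ → V⊆W (⊆V z∉))
  ; ∅-open    = inj₁ ((λ ()) , ∅-open)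
  ; U-open    = inj₂ (tt , ∅ , (λ _ _ _ → [] , λ ()) , (λ _ ()) , λ _ → tt)
  ; ∩-open    = λ {V} {W} → meet {V} {W}
  ; ⋃-open    = λ {I} {V} → union {I} {V}
  }
  where
  τ = euclideanℚ p
  open Topology τ hiding (Open)

  IsOpen : Pred (Pred (Maybe ℚ) p) (lsuc p)
  IsOpen V = (nothing ∉ V × just ⊢ V ∈ Open τ)
           ⊎ (nothing ∈ V × Σ[ K ∈ Pred ℚ p ] Compact τ K × just ⊢ V ≐ ∁ K)

  K-closed : ∀ {V : Pred ℚ p} {K} → Compact τ K → V ≐ ∁ K → V ∈ Open τ
  K-closed cK (V⊆ , ⊆V) = Open-resp (⊆V , V⊆) (compact-closed cK)

  meet : ∀ {V W} → V ∈ IsOpen → W ∈ IsOpen → V ∩ W ∈ IsOpen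
  meet (inj₁ (∞∉V , V-open)) (inj₁ (_ , W-open)) = inj₁ (∞∉V ∘ proj₁ , ∩-open V-open W-open)
  meet (inj₁ (∞∉V , V-open)) (inj₂ (_ , _ , cK , eq)) =
    inj₁ (∞∉V ∘ proj₁ , ∩-open V-open (K-closed cK eq))
  meet (inj₂ (_ , _ , cK , eq)) (inj₁ (∞∉W , W-open)) =
    inj₁ (∞∉W ∘ proj₂ , ∩-open (K-closed cK eq) W-open)
  meet (inj₂ (∞∈V , K , cK , V⊆ , ⊆V)) (inj₂ (∞∈W , K′ , cK′ , W⊆ , ⊆W)) =
    inj₂ ((∞∈V , ∞∈W) , K ∪ K′ , compact-∪ τ cK cK′ ,
          (λ (z∈V , z∈W) → [ V⊆ z∈V , W⊆ z∈W ]′) ,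
          λ z∉ → ⊆V (z∉ ∘ inj₁) , ⊆W (z∉ ∘ inj₂))

  trace-open : ∀ {V} → V ∈ IsOpen → just ⊢ V ∈ Open τ
  trace-open (inj₁ (_ , V-open))      = V-open
  trace-open (inj₂ (_ , _ , cK , eq)) = K-closed cK eq

  union : ∀ {I : Set p} {V : I → Pred (Maybe ℚ) p} → (∀ j → V j ∈ IsOpen) → ⋃ I V ∈ IsOpen
  union {I} {V} V-open with em {P = nothing ∈ ⋃ I V}
  ... | no ∞∉ = inj₁ (∞∉ , ⋃-open (λ j → trace-open {V j} (V-open j)))
  ... | yes (j , ∞∈V) with V-open j
  ...   | inj₁ (∞∉V , _) = contradiction ∞∈V ∞∉V
  ...   | inj₂ (_ , K , cK , V⊆ , ⊆V) =
          inj₂ ((j , ∞∈V) , K ∩ ∁ W , compact-∖ em τ cK (⋃-open (λ j → trace-open {V j} (V-open j))) ,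
                (λ z∈W (_ , z∉W) → z∉W z∈W) , ⊆W)
    where
    W : Pred ℚ p
    W = just ⊢ ⋃ I V
    ⊆W : ∁ (K ∩ ∁ W) ⊆ W
    ⊆W {z} z∉ with em {P = z ∈ W}
    ... | yes z∈W = z∈W
    ... | no  z∉W = j , ⊆V (λ z∈K → z∉ (z∈K , z∉W))

------------------------------------------------------------------------
-- The Appert space

-- Limits of sequences indexed by the positive integers.
_⟶_ : ((n : ℕ) .{{_ : NonZero n}} → ℚ) → ℚ → Set
s ⟶ l = ∀ ε → 0ℚ ℚ.< ε → ∃[ n₀ ] (∀ n .{{_ : NonZero n}} → n₀ ℕ.≤ n → ℚ.∣ s n ℚ.- l ∣ ℚ.< ε)

-- N em n E = |{m ∈ E ∣ m ≤ n}|; the list is 1, …, n.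
N : ExcludedMiddle p → ℕ → Pred ℕ⁺ p → ℕ
N em n E = length (filter (λ m → em {m ∈ E}) (applyUpTo 1+_ n))

private
  module _ (em : ExcludedMiddle p) where
    count : Pred X p → List X → ℕ
    count E xs = length (filter (λ m → em {m ∈ E}) xs)

    count-mono : {E F : Pred X p} → E ⊆ F → ∀ xs → count E xs ℕ.≤ count F xs
    count-mono E⊆F [] = ℕ.z≤n
    count-mono {E = E} {F} E⊆F (m ∷ xs) with em {m ∈ E} | em {m ∈ F}
    ... | yes _   | yes _   = ℕ.s≤s (count-mono E⊆F xs)
    ... | yes m∈E | no  m∉F = contradiction (E⊆F m∈E) m∉F
    ... | no  _   | yes _   = ℕ.m≤n⇒m≤1+n (count-mono E⊆F xs)
    ... | no  _   | no  _   = count-mono E⊆F xs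

    count-U : ∀ (xs : List X) → count U xs ≡ length xs
    count-U xs = cong length (filter-all (λ m → em {m ∈ U}) (All.universal (λ _ → tt) xs))

    count-∩ : (E F : Pred X p) → ∀ xs →
              count E xs ℕ.+ count F xs ℕ.≤ length xs ℕ.+ count (E ∩ F) xs
    count-∩ E F [] = ℕ.z≤n
    count-∩ E F (m ∷ xs) with em {m ∈ E} | em {m ∈ F} | em {m ∈ E ∩ F}
    ... | yes _   | yes _   | yes _    =
      ℕ.s≤s (subst₂ ℕ._≤_ (sym (ℕ.+-suc (count E xs) (count F xs)))
                          (sym (ℕ.+-suc (length xs) (count (E ∩ F) xs)))
                          (ℕ.s≤s (count-∩ E F xs)))
    ... | yes m∈E | yes m∈F | no  m∉   = contradiction (m∈E , m∈F) m∉
    ... | yes _   | no  _   | no  _    = ℕ.s≤s (count-∩ E F xs)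
    ... | no  _   | yes _   | no  _    =
      subst (ℕ._≤ suc (length xs ℕ.+ count (E ∩ F) xs)) (sym (ℕ.+-suc (count E xs) (count F xs)))
            (ℕ.s≤s (count-∩ E F xs))
    ... | no  _   | no  _   | no  _    = ℕ.m≤n⇒m≤1+n (count-∩ E F xs)
    ... | no  m∉E | _       | yes m∈   = contradiction (proj₁ m∈) m∉E
    ... | yes _   | no m∉F  | yes m∈   = contradiction (proj₂ m∈) m∉F

  _÷_ : ℕ → (n : ℕ) .{{_ : NonZero n}} → ℚ
  k ÷ n = ℤ.+ k ℚ./ n

  ÷-+ : ∀ j k n .{{_ : NonZero n}} → j ÷ n ℚ.+ k ÷ n ≡ (j ℕ.+ k) ÷ n
  ÷-+ j k (suc n) = ℚ.toℚᵘ-injective $ begin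
    ℚ.toℚᵘ (j ÷ suc n ℚ.+ k ÷ suc n)                     ≈⟨ ℚ.toℚᵘ-homo-+ (j ÷ suc n) (k ÷ suc n) ⟩
    ℚ.toℚᵘ (j ÷ suc n) ℚᵘ.+ ℚ.toℚᵘ (k ÷ suc n)           ≈⟨ ℚᵘ.+-cong (ℚ.toℚᵘ-fromℚᵘ (frac j)) (ℚ.toℚᵘ-fromℚᵘ (frac k)) ⟩
    frac j ℚᵘ.+ frac k                                   ≈⟨ ℚᵘ.*≡* eq ⟩
    frac (j ℕ.+ k)                                       ≈⟨ ℚ.toℚᵘ-fromℚᵘ (frac (j ℕ.+ k)) ⟨
    ℚ.toℚᵘ ((j ℕ.+ k) ÷ suc n)                           ∎
    where
    open ℚᵘ.≃-Reasoning
    frac : ℕ → ℚᵘ.ℚᵘ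
    frac i = ℚᵘ.mkℚᵘ (ℤ.+ i) n
    d = ℤ.+ suc n
    eq : (ℤ.+ j ℤ.* d ℤ.+ ℤ.+ k ℤ.* d) ℤ.* d ≡ ℤ.+ (j ℕ.+ k) ℤ.* (d ℤ.* d)
    eq = trans (cong (ℤ._* d) (sym (ℤ.*-distribʳ-+ d (ℤ.+ j) (ℤ.+ k)))) (ℤ.*-assoc (ℤ.+ (j ℕ.+ k)) d d)

  n÷n : ∀ n .{{_ : NonZero n}} → n ÷ n ≡ 1ℚ
  n÷n (suc n) = ℚ.toℚᵘ-injective (ℚᵘ.≃-trans (ℚ.toℚᵘ-fromℚᵘ (ℚᵘ.mkℚᵘ (ℤ.+ suc n) n))
                  (ℚᵘ.*≡* (ℤ.*-comm (ℤ.+ suc n) ℤ.1ℤ)))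

  ÷-mono : ∀ {j k} n .{{_ : NonZero n}} → j ℕ.≤ k → j ÷ n ℚ.≤ k ÷ n
  ÷-mono {j} {k} n j≤k = begin
    j ÷ n                     ≡⟨ ℚ.+-identityʳ (j ÷ n) ⟨
    j ÷ n ℚ.+ 0ℚ              ≤⟨ ℚ.+-monoʳ-≤ (j ÷ n) (ℚ.nonNegative⁻¹ _ {{ℚ.normalize-nonNeg (k ℕ.∸ j) n}}) ⟩
    j ÷ n ℚ.+ (k ℕ.∸ j) ÷ n   ≡⟨ ÷-+ j (k ℕ.∸ j) n ⟩
    (j ℕ.+ (k ℕ.∸ j)) ÷ n     ≡⟨ cong (_÷ n) (ℕ.m+[n∸m]≡n j≤k) ⟩
    k ÷ n                     ∎
    where open ℚ.≤-Reasoning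

  deficit : ∀ {k} n .{{_ : NonZero n}} → k ℕ.≤ n → ℚ.∣ k ÷ n ℚ.- 1ℚ ∣ ≡ (n ℕ.∸ k) ÷ n
  deficit {k} n k≤n = begin
    ℚ.∣ k ÷ n ℚ.- 1ℚ ∣                 ≡⟨ ℚ.∣-p∣≡∣p∣ (k ÷ n ℚ.- 1ℚ) ⟨
    ℚ.∣ ℚ.- (k ÷ n ℚ.- 1ℚ) ∣           ≡⟨ cong ℚ.∣_∣ (⁻¹-anti-homo‿- (k ÷ n) 1ℚ) ⟩
    ℚ.∣ 1ℚ ℚ.- k ÷ n ∣                 ≡⟨ cong (λ u → ℚ.∣ u ℚ.- k ÷ n ∣) sum ⟨
    ℚ.∣ k ÷ n ℚ.+ d ℚ.- k ÷ n ∣        ≡⟨ cong ℚ.∣_∣ (xyx⁻¹≈y (k ÷ n) d) ⟩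
    ℚ.∣ d ∣                            ≡⟨ ℚ.0≤p⇒∣p∣≡p (ℚ.nonNegative⁻¹ d {{ℚ.normalize-nonNeg (n ℕ.∸ k) n}}) ⟩
    d                                  ∎
    where
    open ≡-Reasoning
    open AbelianGroupProperties ℚ.+-0-abelianGroup using (⁻¹-anti-homo‿-; xyx⁻¹≈y)
    d = (n ℕ.∸ k) ÷ n
    sum : k ÷ n ℚ.+ d ≡ 1ℚ
    sum = trans (÷-+ k (n ℕ.∸ k) n) (trans (cong (_÷ n) (ℕ.m+[n∸m]≡n k≤n)) (n÷n n))

  half+half : ∀ ε → ε ℚ.* ½ ℚ.+ ε ℚ.* ½ ≡ ε
  half+half ε = trans (sym (ℚ.*-distribˡ-+ ε ½ ½)) (ℚ.*-identityʳ ε)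

  0<half : ∀ {ε} → 0ℚ ℚ.< ε → 0ℚ ℚ.< ε ℚ.* ½
  0<half {ε} 0<ε = subst (ℚ._< ε ℚ.* ½) (ℚ.*-zeroˡ ½) (ℚ.*-monoˡ-<-pos ½ 0<ε)

appert : (∀ {a} → ExcludedMiddle a) → ∀ p → Topology ℕ⁺ p p
appert em p = record
  { Open      = IsOpen
  ; Open-resp = λ where
      (V⊆W , W⊆V) (inj₁ 1∉V)         → inj₁ (1∉V ∘ W⊆V)
      (V⊆W , W⊆V) (inj₂ (1∈V , lim)) → inj₂ (V⊆W 1∈V , grow V⊆W lim)
  ; ∅-open    = inj₁ λ ()
  ; U-open    = inj₂ (tt , λ ε 0<ε → 0 , λ n _ →
                  subst (ℚ._< ε) (sym (trans (cong (λ k → ℚ.∣ k ÷ n ℚ.- 1ℚ ∣)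
                    (trans (count-U em (applyUpTo 1+_ n)) (length-applyUpTo 1+_ n)))
                    (cong (λ u → ℚ.∣ u ℚ.- 1ℚ ∣) (n÷n n)))) 0<ε)
  ; ∩-open    = λ where
      (inj₁ 1∉V)       _                → inj₁ (1∉V ∘ proj₁)
      (inj₂ _)         (inj₁ 1∉W)       → inj₁ (1∉W ∘ proj₂)
      (inj₂ (1∈V , s)) (inj₂ (1∈W , t)) → inj₂ ((1∈V , 1∈W) , meet s t)
  ; ⋃-open    = union
  }
  where
  FullDensity : Pred ℕ⁺ p → Set
  FullDensity E = (λ n → ℤ.+ N em n E ℚ./ n) ⟶ 1ℚ

  IsOpen : Pred (Pred ℕ⁺ p) p
  IsOpen E = (1+ 0) ∉ E ⊎ (1+ 0) ∈ E × FullDensity E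

  N≤n : ∀ n E → N em n E ℕ.≤ n
  N≤n n E = subst (N em n E ℕ.≤_) (length-applyUpTo 1+_ n) (length-filter _ (applyUpTo 1+_ n))

  grow : ∀ {E F} → E ⊆ F → FullDensity E → FullDensity F
  grow {E} {F} E⊆F lim ε 0<ε = let n₀ , close = lim ε 0<ε in n₀ , λ n n₀≤n → begin-strict
    ℚ.∣ N em n F ÷ n ℚ.- 1ℚ ∣   ≡⟨ deficit n (N≤n n F) ⟩
    (n ℕ.∸ N em n F) ÷ n        ≤⟨ ÷-mono n (ℕ.∸-monoʳ-≤ n (count-mono em E⊆F (applyUpTo 1+_ n))) ⟩
    (n ℕ.∸ N em n E) ÷ n        ≡⟨ deficit n (N≤n n E) ⟨
    ℚ.∣ N em n E ÷ n ℚ.- 1ℚ ∣   <⟨ close n n₀≤n ⟩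
    ε                           ∎
    where open ℚ.≤-Reasoning

  deficit-∩ : ∀ n E F → n ℕ.∸ N em n (E ∩ F) ℕ.≤ (n ℕ.∸ N em n E) ℕ.+ (n ℕ.∸ N em n F)
  deficit-∩ n E F = ℕ.m≤n+o⇒m∸n≤o n c (ℕ.+-cancelʳ-≤ (g ℕ.+ h) n _ (begin
    n ℕ.+ (g ℕ.+ h)                           ≤⟨ ℕ.+-monoʳ-≤ n ∩≤ ⟩
    n ℕ.+ (n ℕ.+ c)                             ≡⟨ ℕ.+-assoc n n c ⟨
    n ℕ.+ n ℕ.+ c                               ≡⟨ cong (ℕ._+ c) (cong₂ ℕ._+_ (ℕ.m∸n+n≡m (N≤n n E)) (ℕ.m∸n+n≡m (N≤n n F))) ⟨
    (d ℕ.+ g) ℕ.+ (e ℕ.+ h) ℕ.+ c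
      ≡⟨ solve 5 (λ d g e h c → (d :+ g) :+ (e :+ h) :+ c := c :+ (d :+ e) :+ (g :+ h)) refl d g e h c ⟩
    c ℕ.+ (d ℕ.+ e) ℕ.+ (g ℕ.+ h)             ∎))
    where
    open ℕ.≤-Reasoning
    open +-*-Solver
    g = N em n E
    h = N em n F
    c  = N em n (E ∩ F)
    d  = n ℕ.∸ g
    e  = n ℕ.∸ h
    ∩≤ : g ℕ.+ h ℕ.≤ n ℕ.+ c
    ∩≤ = subst (λ l → g ℕ.+ h ℕ.≤ l ℕ.+ c) (length-applyUpTo 1+_ n) (count-∩ em E F (applyUpTo 1+_ n))

  meet : ∀ {E F} → FullDensity E → FullDensity F → FullDensity (E ∩ F)
  meet {E} {F} limE limF ε 0<ε =
    let n₁ , closeE = limE (ε ℚ.* ½) (0<half 0<ε)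
        n₂ , closeF = limF (ε ℚ.* ½) (0<half 0<ε)
    in n₁ ℕ.+ n₂ , λ n n₀≤n → begin-strict
      ℚ.∣ N em n (E ∩ F) ÷ n ℚ.- 1ℚ ∣
        ≡⟨ deficit n (N≤n n (E ∩ F)) ⟩
      (n ℕ.∸ N em n (E ∩ F)) ÷ n
        ≤⟨ ÷-mono n (deficit-∩ n E F) ⟩
      ((n ℕ.∸ N em n E) ℕ.+ (n ℕ.∸ N em n F)) ÷ n
        ≡⟨ ÷-+ (n ℕ.∸ N em n E) (n ℕ.∸ N em n F) n ⟨
      (n ℕ.∸ N em n E) ÷ n ℚ.+ (n ℕ.∸ N em n F) ÷ n
        ≡⟨ cong₂ ℚ._+_ (deficit n (N≤n n E)) (deficit n (N≤n n F)) ⟨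
      ℚ.∣ N em n E ÷ n ℚ.- 1ℚ ∣ ℚ.+ ℚ.∣ N em n F ÷ n ℚ.- 1ℚ ∣
        <⟨ ℚ.+-mono-< (closeE n (ℕ.≤-trans (ℕ.m≤m+n n₁ n₂) n₀≤n)) (closeF n (ℕ.≤-trans (ℕ.m≤n+m n₂ n₁) n₀≤n)) ⟩
      ε ℚ.* ½ ℚ.+ ε ℚ.* ½
        ≡⟨ half+half ε ⟩
      ε ∎
    where open ℚ.≤-Reasoning

  union : ∀ {I : Set p} {V : I → Pred ℕ⁺ p} → (∀ j → V j ∈ IsOpen) → ⋃ I V ∈ IsOpen
  union {I} {V} V-open with em {P = (1+ 0) ∈ ⋃ I V}
  ... | no 1∉ = inj₁ 1∉
  ... | yes (j , 1∈V) with V-open j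
  ...   | inj₁ 1∉V       = contradiction 1∈V 1∉V
  ...   | inj₂ (_ , lim) = inj₂ ((j , 1∈V) , grow {V j} (j ,_) lim)

{-# OPTIONS --safe #-}

-- A countable definable space has a countable basis, whereas each of the four
-- spaces is countable and has a point without a countable neighbourhood basis.
--
-- For the first claim, let D ⊆ Mⁿ be countable and R ⊆ Mⁿ × Mᵏ definable; then
-- the fibres R(·, b), b ∈ Mᵏ, have only countably many traces on D.  By
-- induction on k: split b into its first coordinate c and the rest b′.  By
-- o-minimality each {c ∣ R(d, c, b′)} has finite boundary.  Let E(b′) be the
-- union of these boundaries over d ∈ D; it is definable, so its boundary is
-- finite as well.  Either c is the i-th boundary point for some d ∈ D, or the
-- i-th boundary point of E(b′), or c lies in the i-th interval of the
-- complement of E(b′), throughout which the trace of R(·, c, b′) is constant.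
-- In each of these countably many cases the trace is a definable function of b′.

module Submission where

open import Defs
import Algebra.Properties.AbelianGroup as AbelianGroupProperties
open import Axiom.ExcludedMiddle using (ExcludedMiddle)
open import Data.Empty using (⊥-elim)
open import Data.Fin.Base using (Fin; zero; suc; _↑ˡ_; _↑ʳ_; splitAt)
import Data.Integer as ℤ
import Data.Integer.Properties as ℤ
import Data.Irrelevant as Irrelevant
open import Data.List.Base using (List; []; _∷_; applyUpTo; concatMap; filter; length; map)
  renaming (_++_ to _++ˡ_)
open import Data.List.Membership.Propositional using (find) renaming (_∈_ to _∈ˡ_)
open import Data.List.Membership.Propositional.Properties
  using (∈-++⁺ˡ; ∈-++⁺ʳ; ∈-applyUpTo⁺; ∈-map⁺)
open import Data.List.Properties
  using (applyUpTo-∷ʳ; filter-++; filter-accept; filter-reject; length-++)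
open import Data.List.Relation.Unary.Any as Any using (Any; here; there)
open import Data.Maybe.Base using (Maybe; just; nothing)
open import Data.Nat using (ℕ; zero; suc; _+_; _*_; _∸_; s≤s; z≤n; NonZero)
import Data.Nat as ℕ
import Data.Nat.Properties as ℕ
open import Data.Product using (_×_; _,_; proj₁; proj₂; Σ-syntax; ∃-syntax; map₂)
open import Data.Product.Function.NonDependent.Propositional using (_×-⇔_; _×-↣_)
open import Data.Rational using (ℚ; mkℚ; 0ℚ; 1ℚ; ½)
import Data.Rational as ℚ
import Data.Rational.Properties as ℚ
import Data.Rational.Unnormalised as ℚᵘ
import Data.Rational.Unnormalised.Properties as ℚᵘ
open import Data.Refinement using (Refinement-syntax; value; proof; _,_)
open import Data.Sum using (_⊎_; inj₁; inj₂; [_,_]′)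
open import Data.Sum.Function.Propositional using (_⊎-⇔_; _⊎-↣_)
open import Data.Unit.Polymorphic using (⊤; tt)
open import Data.Vec using (Vec; []; _∷_; _++_; head; tail; lookup; take; drop)
open import Data.Vec.Properties using (lookup-++ˡ; lookup-++ʳ; lookup-splitAt; take++drop≡id)
open import Function using (_∘_; _$_; id; _⇔_; mk⇔; Equivalence; _↣_; mk↣; Injection; Inverse)
open import Function.Construct.Composition using (_↣-∘_)
open import Function.Construct.Identity using (↣-id)
open import Function.Properties.Equivalence using ()
  renaming (refl to ⇔-refl; sym to ⇔-sym; trans to ⇔-trans)
open import Function.Properties.Inverse using (Inverse⇒Injection)
open import Function.Related.Propositional using (≡⇒)
open import Function.Related.TypeIsomorphisms using (→-cong-⇔)
open import Level using (Level; Lift; lift; lower; _⊔_)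
import Relation.Binary.Construct.Add.Extrema.Strict as Extrema
import Relation.Binary.Construct.Add.Supremum.Strict as Supremum
open import Relation.Binary.Definitions using (tri<; tri≈; tri>)
open import Relation.Binary.PropositionalEquality hiding ([_]; J)
open import Relation.Binary.Structures using (IsDenseLinearOrder)
open import Relation.Nullary using (¬_; Dec; yes; no; contradiction; recompute)
open import Relation.Nullary.Construct.Add.Extrema using (_±; [_]; ⊥±; ⊤±)
open import Relation.Nullary.Decidable using (decidable-stable)
open import Relation.Unary using (Pred; _⊆_; _∈_; _∉_; _⊢_; ∁; ⋃)

private variable
  f r o ℓ : Level
  L : Language f r
  X : Set o
  k m n : ℕ

-- Definable sets

mutual
  renameTerm : (Fin m → Fin n) → Term L m → Term L n
  renameTerm ρ (var i)    = var (ρ i)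
  renameTerm ρ (fun g ts) = fun g (renameTerms ρ ts)

  renameTerms : (Fin m → Fin n) → Vec (Term L m) k → Vec (Term L n) k
  renameTerms ρ []       = []
  renameTerms ρ (t ∷ ts) = renameTerm ρ t ∷ renameTerms ρ ts

extend : (Fin m → Fin n) → Fin (suc m) → Fin (suc n)
extend ρ zero    = zero
extend ρ (suc i) = suc (ρ i)

rename : (Fin m → Fin n) → Formula L m → Formula L n
rename ρ (s ≋ t)    = renameTerm ρ s ≋ renameTerm ρ t
rename ρ (s ≺ t)    = renameTerm ρ s ≺ renameTerm ρ t
rename ρ (rel R ts) = rel R (renameTerms ρ ts)
rename ρ ⊥̇          = ⊥̇
rename ρ (φ ∧̇ ψ)    = rename ρ φ ∧̇ rename ρ ψ
rename ρ (φ ∨̇ ψ)    = rename ρ φ ∨̇ rename ρ ψ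
rename ρ (φ ⇒̇ ψ)    = rename ρ φ ⇒̇ rename ρ ψ
rename ρ (∀̇ φ)      = ∀̇ rename (extend ρ) φ
rename ρ (∃̇ φ)      = ∃̇ rename (extend ρ) φ

module Definability {f r ℓ} {L : Language f r} (M : Structure L ℓ) where
  open Equivalence using (to; from)
  open Structure M renaming (Carrier to C)

  Agree : (Fin m → Fin n) → Vec C m → Vec C n → Set ℓ
  Agree ρ v w = ∀ i → lookup v i ≡ lookup w (ρ i)

  mutual
    ⟦renameTerm⟧ : ∀ {ρ : Fin m → Fin n} {v w} → Agree ρ v w →
                   ∀ t → ⟦_⟧ M t v ≡ ⟦_⟧ M (renameTerm ρ t) w
    ⟦renameTerm⟧ eq (var i)    = eq i
    ⟦renameTerm⟧ eq (fun g ts) = cong (⟦fun⟧ g) (⟦renameTerms⟧ eq ts)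

    ⟦renameTerms⟧ : ∀ {ρ : Fin m → Fin n} {v w} → Agree ρ v w →
                    ∀ (ts : Vec _ k) → ⟦_⟧* M ts v ≡ ⟦_⟧* M (renameTerms ρ ts) w
    ⟦renameTerms⟧ eq []       = refl
    ⟦renameTerms⟧ eq (t ∷ ts) = cong₂ _∷_ (⟦renameTerm⟧ eq t) (⟦renameTerms⟧ eq ts)

  agree-extend : ∀ {ρ : Fin m → Fin n} {v w} → Agree ρ v w → ∀ c → Agree (extend ρ) (c ∷ v) (c ∷ w)
  agree-extend eq c zero    = refl
  agree-extend eq c (suc i) = eq i

  ∀-cong-⇔ : {P Q : C → Set ℓ} → (∀ c → P c ⇔ Q c) → (∀ c → P c) ⇔ (∀ c → Q c)
  ∀-cong-⇔ eq = mk⇔ (λ p c → to (eq c) (p c)) (λ q c → from (eq c) (q c))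

  ∃-cong-⇔ : {P Q : C → Set ℓ} → (∀ c → P c ⇔ Q c) → (∃[ c ] P c) ⇔ (∃[ c ] Q c)
  ∃-cong-⇔ eq = mk⇔ (map₂ (to (eq _))) (map₂ (from (eq _)))

  ⊨rename : ∀ {ρ : Fin m → Fin n} {v w} → Agree ρ v w →
            ∀ φ → (M ⊨ φ [ v ]) ⇔ (M ⊨ rename ρ φ [ w ])
  ⊨rename eq (s ≋ t)    = ≡⇒ (cong₂ _≡_ (⟦renameTerm⟧ eq s) (⟦renameTerm⟧ eq t))
  ⊨rename eq (s ≺ t)    = ≡⇒ (cong₂ _<_ (⟦renameTerm⟧ eq s) (⟦renameTerm⟧ eq t))
  ⊨rename eq (rel R ts) = ≡⇒ (cong (⟦rel⟧ R) (⟦renameTerms⟧ eq ts))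
  ⊨rename eq ⊥̇          = ⇔-refl
  ⊨rename eq (φ ∧̇ ψ)    = ⊨rename eq φ ×-⇔ ⊨rename eq ψ
  ⊨rename eq (φ ∨̇ ψ)    = ⊨rename eq φ ⊎-⇔ ⊨rename eq ψ
  ⊨rename eq (φ ⇒̇ ψ)    = →-cong-⇔ (⊨rename eq φ) (⊨rename eq ψ)
  ⊨rename eq (∀̇ φ)      = ∀-cong-⇔ λ c → ⊨rename (agree-extend eq c) φ
  ⊨rename eq (∃̇ φ)      = ∃-cong-⇔ λ c → ⊨rename (agree-extend eq c) φ

  -- A map that only permutes, repeats or drops coordinates acts on formulas by renaming variables,
  -- so definability survives composition with it.
  record Coordinates (g : Vec C n → Vec C m) : Set ℓ where
    constructor _,_
    field
      index : Fin m → Fin n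
      agree : ∀ v → Agree index (g v) v

  record Coordinate (t : Vec C n → C) : Set ℓ where
    constructor _,_
    field
      index : Fin n
      agree : ∀ v → t v ≡ lookup v index

  open Coordinates using (index)

  _∘ᶜ_ : {g : Vec C m → Vec C k} {h : Vec C n → Vec C m} →
         Coordinates g → Coordinates h → Coordinates (g ∘ h)
  _∘ᶜ_ {h = h} (ρ , eq) (σ , eq′) = σ ∘ ρ , λ v i → trans (eq (h v) i) (eq′ v (ρ i))

  _++ᶜ_ : {g : Vec C n → Vec C m} {h : Vec C n → Vec C k} →
          Coordinates g → Coordinates h → Coordinates (λ v → g v ++ h v)
  _++ᶜ_ {m = m} {g = g} {h} (ρ , eq) (σ , eq′) = [ ρ , σ ]′ ∘ splitAt m , agree
    where
    agree : ∀ v → Agree ([ ρ , σ ]′ ∘ splitAt m) (g v ++ h v) v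
    agree v i rewrite lookup-splitAt m (g v) (h v) i with splitAt m i
    ... | inj₁ j = eq v j
    ... | inj₂ j = eq′ v j

  _∷ᶜ_ : {t : Vec C n → C} {g : Vec C n → Vec C m} →
         Coordinate t → Coordinates g → Coordinates (λ v → t v ∷ g v)
  (i , t≡) ∷ᶜ (ρ , eq) = (λ { zero → i ; (suc j) → ρ j }) , λ { v zero → t≡ v ; v (suc j) → eq v j }

  take-coords : ∀ m → Coordinates {m + n} (take m)
  take-coords {n} m = _↑ˡ n , λ v i → trans (sym (lookup-++ˡ (take m v) (drop m v) i))
                                       (cong (λ w → lookup w (i ↑ˡ n)) (take++drop≡id m v))

  drop-coords : ∀ m → Coordinates {m + n} (drop m)
  drop-coords m = m ↑ʳ_ , λ v i → trans (sym (lookup-++ʳ (take m v) (drop m v) i))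
                                   (cong (λ w → lookup w (m ↑ʳ i)) (take++drop≡id m v))

  tail-coords : Coordinates {suc n} tail
  tail-coords = suc , λ { (_ ∷ _) i → refl }

  head-coord : Coordinate {suc n} head
  head-coord = zero , λ { (_ ∷ _) → refl }

  _∘ᵗ_ : {t : Vec C m → C} {h : Vec C n → Vec C m} →
         Coordinate t → Coordinates h → Coordinate (t ∘ h)
  _∘ᵗ_ {h = h} (i , t≡) (ρ , eq) = ρ i , λ v → trans (t≡ (h v)) (eq v i)

  -- Records rather than functions, so that S and R can be inferred from the
  -- types of definability proofs.
  record Def (S : Pred (Vec C n) ℓ) : Set (f ⊔ r ⊔ ℓ) where
    constructor def
    field definable : Definable M S

  record Def₁ (S : Vec C k → Pred C ℓ) : Set (f ⊔ r ⊔ ℓ) where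
    constructor def₁
    field uncurried : Def (λ w → S (tail w) (head w))

  record Def₂ (R : Vec C n → Pred (Vec C k) ℓ) : Set (f ⊔ r ⊔ ℓ) where
    constructor def₂
    field uncurried : Def (λ w → R (take n w) (drop n w))

  private
    ⊨-subst : {g : Vec C n → Vec C m} → (c : Coordinates g) → ∀ φ {v w} → g v ≡ w →
              (M ⊨ rename (index c) φ [ v ]) ⇔ (M ⊨ φ [ w ])
    ⊨-subst (ρ , eq) φ {v} refl = ⇔-sym (⊨rename (eq v) φ)

  -- Closure properties of definable sets

  def-⇔ : {S T : Pred (Vec C n) ℓ} → (∀ v → S v ⇔ T v) → Def S → Def T
  def-⇔ eq (def (m , φ , c , S⊆ , ⊆S)) = def $
    m , φ , c , (λ t → S⊆ (from (eq _) t)) , λ s → to (eq _) (⊆S s)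

  take-++ : ∀ (v : Vec C m) (w : Vec C n) → take m (v ++ w) ≡ v
  take-++ []      w = refl
  take-++ (z ∷ v) w = cong (z ∷_) (take-++ v w)

  drop-++ : ∀ (v : Vec C m) (w : Vec C n) → drop m (v ++ w) ≡ w
  drop-++ []      w = refl
  drop-++ (z ∷ v) w = drop-++ v w

  def-∘ : {S : Pred (Vec C m) ℓ} {g : Vec C n → Vec C m} → Def S → Coordinates g → Def (S ∘ g)
  def-∘ {n = n} {g = g} (def (l , φ , c , S⊆ , ⊆S)) cg = def $
    l , rename (index ch) φ , c ,
    (λ {v} s → from (⊨-subst ch φ (h≡ v)) (S⊆ s)) , λ {v} t → ⊆S (to (⊨-subst ch φ (h≡ v)) t)
    where
    ch : Coordinates (λ w → g (take n w) ++ drop n w)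
    ch = (cg ∘ᶜ take-coords n) ++ᶜ drop-coords n
    h≡ : ∀ (v : Vec C n) → g (take n (v ++ c)) ++ drop n (v ++ c) ≡ g v ++ c
    h≡ v = cong₂ _++_ (cong g (take-++ v c)) (drop-++ v c)

  -- The fixed coordinates `d` are moved in front of the old parameters `c`; the renaming reads
  -- `(d ++ v) ++ c` off `v ++ (d ++ c)`.
  def-at : {S : Pred (Vec C (m + n)) ℓ} → Def S → ∀ (d : Vec C m) → Def (λ (v : Vec C n) → S (d ++ v))
  def-at {m = m} {n = n} (def (l , φ , c , S⊆ , ⊆S)) d = def $
    m + l , rename (index ch) φ , d ++ c ,
    (λ {v} s → from (⊨-subst ch φ (h≡ v)) (S⊆ s)) , λ {v} t → ⊆S (to (⊨-subst ch φ (h≡ v)) t)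
    where
    ch : Coordinates (λ w → (take m (drop n w) ++ take n w) ++ drop m (drop n w))
    ch = ((take-coords m ∘ᶜ drop-coords n) ++ᶜ take-coords n) ++ᶜ (drop-coords m ∘ᶜ drop-coords n)
    h≡ : ∀ (v : Vec C n) → (take m (drop n (v ++ d ++ c)) ++ take n (v ++ d ++ c)) ++
               drop m (drop n (v ++ d ++ c)) ≡ (d ++ v) ++ c
    h≡ v rewrite drop-++ v (d ++ c) | take-++ v (d ++ c) | take-++ d c | drop-++ d c = refl

  private
    DefinableWith : ∀ {m} → Vec C m → Pred (Vec C n) ℓ → Set _
    DefinableWith {n} {m} c S = Σ[ φ ∈ Formula L (n + m) ] ∀ v → S v ⇔ (M ⊨ φ [ v ++ c ])

    -- Concatenating the two parameter tuples lets binary connectives be applied directly to the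
    -- formulas.
    common : {S T : Pred (Vec C n) ℓ} → Def S → Def T →
             ∃[ l ] Σ[ c ∈ Vec C l ] DefinableWith c S × DefinableWith c T
    common {n} (def (l , φ , c , S⊆ , ⊆S)) (def (l′ , ψ , d , T⊆ , ⊆T)) =
      l + l′ , c ++ d ,
      (rename (index cg) φ , λ v → ⇔-trans (mk⇔ S⊆ ⊆S) (⇔-sym (⊨-subst cg φ (g≡ v)))) ,
      (rename (index ch) ψ , λ v → ⇔-trans (mk⇔ T⊆ ⊆T) (⇔-sym (⊨-subst ch ψ (h≡ v))))
      where
      cg : Coordinates (λ w → take n w ++ take l (drop n w))
      cg = take-coords n ++ᶜ (take-coords l ∘ᶜ drop-coords n)
      ch : Coordinates (λ w → take n w ++ drop l (drop n w))
      ch = take-coords n ++ᶜ (drop-coords l ∘ᶜ drop-coords n)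
      g≡ : ∀ (v : Vec C n) → take n (v ++ c ++ d) ++ take l (drop n (v ++ c ++ d)) ≡ v ++ c
      g≡ v rewrite drop-++ v (c ++ d) | take-++ v (c ++ d) | take-++ c d = refl
      h≡ : ∀ (v : Vec C n) → take n (v ++ c ++ d) ++ drop l (drop n (v ++ c ++ d)) ≡ v ++ d
      h≡ v rewrite drop-++ v (c ++ d) | take-++ v (c ++ d) | drop-++ c d = refl

    fromWith : {S : Pred (Vec C n) ℓ} (c : Vec C m) (φ : Formula L (n + m)) →
               (∀ v → S v ⇔ (M ⊨ φ [ v ++ c ])) → Def S
    fromWith c φ eq = def $ _ , φ , c , (λ s → to (eq _) s) , λ t → from (eq _) t

  def-formula : (φ : Formula L n) → Def (λ v → M ⊨ φ [ v ])
  def-formula φ = fromWith [] (rename (_↑ˡ 0) φ) λ v → ⊨rename (λ i → sym (lookup-++ˡ v [] i)) φ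

  def-× : {S T : Pred (Vec C n) ℓ} → Def S → Def T → Def (λ v → S v × T v)
  def-× s t with common s t
  ... | _ , c , (φ , eq) , (ψ , eq′) = fromWith c (φ ∧̇ ψ) λ v → eq v ×-⇔ eq′ v

  def-→ : {S T : Pred (Vec C n) ℓ} → Def S → Def T → Def (λ v → S v → T v)
  def-→ s t with common s t
  ... | _ , c , (φ , eq) , (ψ , eq′) = fromWith c (φ ⇒̇ ψ) λ v → →-cong-⇔ (eq v) (eq′ v)

  def-¬ : {S : Pred (Vec C n) ℓ} → Def S → Def (λ v → ¬ S v)
  def-¬ (def (l , φ , c , S⊆ , ⊆S)) = fromWith c (φ ⇒̇ ⊥̇) λ v →
    →-cong-⇔ (mk⇔ S⊆ ⊆S) (mk⇔ (λ ()) λ ())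

  def-⊤ : Def {n} (λ _ → ⊤)
  def-⊤ = fromWith [] (⊥̇ ⇒̇ ⊥̇) λ v → mk⇔ (λ _ ()) (λ _ → tt)

  def-< : {s t : Vec C n → C} → Coordinate s → Coordinate t → Def (λ v → s v < t v)
  def-< {n} (i , s≡) (j , t≡) = fromWith [] (var (i ↑ˡ 0) ≺ var (j ↑ˡ 0)) λ v →
    ≡⇒ (cong₂ _<_ (trans (s≡ v) (sym (lookup-++ˡ v [] i))) (trans (t≡ v) (sym (lookup-++ˡ v [] j))))

  def-∃ : {S : Vec C n → Pred C ℓ} → Def₁ S → Def (λ v → ∃[ c ] S v c)
  def-∃ (def₁ (def (l , φ , c , S⊆ , ⊆S))) = fromWith c (∃̇ φ) λ v → ∃-cong-⇔ λ d → mk⇔ S⊆ ⊆S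

  def-∀ : {S : Vec C n → Pred C ℓ} → Def₁ S → Def (λ v → ∀ c → S v c)
  def-∀ (def₁ (def (l , φ , c , S⊆ , ⊆S))) = fromWith c (∀̇ φ) λ v → ∀-cong-⇔ λ d → mk⇔ S⊆ ⊆S

  apply₁ : {S : Vec C k → Pred C ℓ} {g : Vec C n → Vec C k} {t : Vec C n → C} →
           Def₁ S → Coordinates g → Coordinate t → Def (λ v → S (g v) (t v))
  apply₁ (def₁ s) g t = def-∘ s (t ∷ᶜ g)

  apply₂ : {R : Vec C m → Pred (Vec C k) ℓ} {g : Vec C n → Vec C m} {h : Vec C n → Vec C k} →
           Def₂ R → Coordinates g → Coordinates h → Def (λ v → R (g v) (h v))
  apply₂ {R = R} {g} {h} (def₂ r) cg ch = def-⇔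
    (λ v → ≡⇒ (cong₂ R (take-++ (g v) (h v)) (drop-++ (g v) (h v)))) (def-∘ r (cg ++ᶜ ch))

  at₂ : {R : Vec C m → Pred (Vec C k) ℓ} → Def₂ R → ∀ d → Def (R d)
  at₂ {R = R} (def₂ r) d = def-⇔ (λ v → ≡⇒ (cong₂ R (take-++ d v) (drop-++ d v))) (def-at r d)

  def-∃* : ∀ n {R : Vec C n → Pred (Vec C k) ℓ} → Def₂ R → Def (λ v → ∃[ d ] R d v)
  def-∃* zero    (def₂ r) = def-⇔ (λ v → mk⇔ ([] ,_) λ { ([] , p) → p }) r
  def-∃* (suc n) {R} r = def-⇔
    (λ v → mk⇔ (λ (d , c , p) → c ∷ d , p) λ { (c ∷ d , p) → d , c , p })
    (def-∃* n {λ d v → ∃[ c ] R (c ∷ d) v} (def₂ (def-∃ {S = λ w c → R (c ∷ take n w) (drop n w)} (def₁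
      (apply₂ r (head-coord ∷ᶜ (take-coords n ∘ᶜ tail-coords)) (drop-coords n ∘ᶜ tail-coords))))))

-- Boundaries of definable subsets of the line

module Tameness (em : ∀ {a} → ExcludedMiddle a) {f r ℓ : Level} {L : Language f r}
                (M : Structure L ℓ) (om : OMinimal M) where
  open Equivalence using (to; from)
  open Structure M renaming (Carrier to C)
  open OMinimal om
  open IsDenseLinearOrder isDenseLinearOrder using (compare; dense; _<?_)
    renaming (trans to <-trans; irrefl to <-irrefl)
  open Definability M
  open Extrema _<_ using (_<±_; ⊥±<[_]; [_]<⊤±; [<]-injective) renaming ([_] to [_]ˢ)

  <⇒≯ : ∀ {a b} → a < b → ¬ b < a
  <⇒≯ a<b b<a = <-irrefl refl (<-trans a<b b<a)

  <-≮-trans : ∀ {a b c} → a < b → ¬ c < b → a < c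
  <-≮-trans {a} {b} {c} a<b c≮b with compare b c
  ... | tri< b<c _ _  = <-trans a<b b<c
  ... | tri≈ _ refl _ = a<b
  ... | tri> _ _ c<b  = contradiction c<b c≮b

  ≮-<-trans : ∀ {a b c} → ¬ b < a → b < c → a < c
  ≮-<-trans {a} {b} {c} b≮a b<c with compare a b
  ... | tri< a<b _ _  = <-trans a<b b<c
  ... | tri≈ _ refl _ = b<c
  ... | tri> _ _ b<a  = contradiction b<a b≮a

  ≮-trans : ∀ {a b c} → ¬ b < a → ¬ c < b → ¬ c < a
  ≮-trans b≮a c≮b c<a = b≮a (≮-<-trans c≮b c<a)

  -- An implication is enough, since `s` and `t` may be exchanged.
  ConstantOn : Pred C ℓ → C → C → Set ℓ
  ConstantOn S a b = ∀ s t → (a < s × s < b) × (a < t × t < b) → S s → S t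

  LocallyConstant : Pred C ℓ → Pred C ℓ
  LocallyConstant S e = ∃[ a ] ∃[ b ] (a < e × e < b) × ConstantOn S a b

  -- Classically this is the topological boundary. Quantifying over interval endpoints makes it
  -- first-order in `S`, hence definable along with `S`.
  Boundary : Pred C ℓ → Pred C ℓ
  Boundary S e = ¬ LocallyConstant S e

  -- For `s < t` this says that `F` misses the closed interval from `s` to `t`.
  Avoids : List C → C → C → Set ℓ
  Avoids F s t = ∀ {e} → e ∈ˡ F → e < s ⊎ t < e

  endpoints± : C ± → List C
  endpoints± [ a ] = a ∷ []
  endpoints± _     = []

  endpoints : Piece M → List C
  endpoints (point a)      = a ∷ []
  endpoints (interval a b) = endpoints± a ++ˡ endpoints± b

  ray-above : ∀ a {s t} → s < t → Avoids (endpoints± a) s t → (a <± [ s ]) ⇔ (a <± [ t ])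
  ray-above ⊥±    s<t av = mk⇔ (λ _ → ⊥±<[ _ ]) (λ _ → ⊥±<[ _ ])
  ray-above ⊤±    s<t av = mk⇔ (λ ()) (λ ())
  ray-above [ a ] s<t av with av (here refl)
  ... | inj₁ a<s = mk⇔ (λ _ → [ <-trans a<s s<t ]ˢ) (λ _ → [ a<s ]ˢ)
  ... | inj₂ t<a = mk⇔ (λ a<s → [ <-trans ([<]-injective a<s) s<t ]ˢ)
                       (λ a<t → contradiction (<-trans t<a ([<]-injective a<t)) (<-irrefl refl))

  ray-below : ∀ b {s t} → s < t → Avoids (endpoints± b) s t → ([ s ] <± b) ⇔ ([ t ] <± b)
  ray-below ⊥±    s<t av = mk⇔ (λ { Supremum.[ () ] }) (λ { Supremum.[ () ] })
  ray-below ⊤±    s<t av = mk⇔ (λ _ → [ _ ]<⊤±) (λ _ → [ _ ]<⊤±)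
  ray-below [ b ] s<t av with av (here refl)
  ... | inj₂ t<b = mk⇔ (λ _ → [ t<b ]ˢ) (λ _ → [ <-trans s<t t<b ]ˢ)
  ... | inj₁ b<s = mk⇔ (λ s<b → contradiction (<-trans b<s ([<]-injective s<b)) (<-irrefl refl))
                       (λ t<b → [ <-trans s<t ([<]-injective t<b) ]ˢ)

  piece-constant : ∀ p {s t} → s < t → Avoids (endpoints p) s t → (_∈ᵖ_ M s p) ⇔ (_∈ᵖ_ M t p)
  piece-constant (point a) s<t av with av (here refl)
  ... | inj₁ a<s = mk⇔ (λ { refl → contradiction a<s (<-irrefl refl) })
                       (λ { refl → contradiction (<-trans a<s s<t) (<-irrefl refl) })
  ... | inj₂ t<a = mk⇔ (λ { refl → contradiction (<-trans s<t t<a) (<-irrefl refl) })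
                       (λ { refl → contradiction t<a (<-irrefl refl) })
  piece-constant (interval a b) s<t av =
    ray-above a s<t (av ∘ ∈-++⁺ˡ) ×-⇔ ray-below b s<t (av ∘ ∈-++⁺ʳ (endpoints± a))

  pieces-constant : ∀ ps {s t} → s < t → Avoids (concatMap endpoints ps) s t →
                    Any (_∈ᵖ_ M s) ps ⇔ Any (_∈ᵖ_ M t) ps
  pieces-constant []       s<t av = mk⇔ (λ ()) (λ ())
  pieces-constant (p ∷ ps) s<t av = mk⇔
    (λ { (here s∈) → here (to hd s∈) ; (there s∈) → there (to tl s∈) })
    (λ { (here t∈) → here (from hd t∈) ; (there t∈) → there (from tl t∈) })
    where
    hd = piece-constant p s<t (av ∘ ∈-++⁺ˡ)
    tl = pieces-constant ps s<t (av ∘ ∈-++⁺ʳ (endpoints p))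

  CutBy : Pred C ℓ → List C → Set ℓ
  CutBy S F = ∀ {s t} → s < t → Avoids F s t → S s ⇔ S t

  at₁ : {S : Vec C k → Pred C ℓ} → Def₁ S → ∀ b → Definable M {n = 1} (λ v → S b (head v))
  at₁ {k} {S} s b = Def.definable (def-⇔ eq (def-at {m = k} {n = 1} s′ b))
    where
    s′ : Def (λ v → S (take k v) (head (drop k v)))
    s′ = apply₁ s (take-coords k) (head-coord ∘ᵗ drop-coords k)
    eq : ∀ v → S (take k (b ++ v)) (head (drop k (b ++ v))) ⇔ S b (head v)
    eq v = ≡⇒ (cong₂ S (take-++ b v) (cong head (drop-++ b v)))

  -- This is where tameness enters: membership in a finite union of points and intervals can only
  -- change at one of their endpoints.
  cut : {S : Vec C k → Pred C ℓ} → Def₁ S → ∀ b → ∃[ F ] CutBy (S b) F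
  cut {S = S} s b with tame (S b) (at₁ s b)
  ... | ps , S⊆ , ⊆S = concatMap endpoints ps , λ s<t av →
    ⇔-trans (mk⇔ S⊆ ⊆S) (⇔-trans (pieces-constant ps s<t av) (mk⇔ ⊆S S⊆))

  max-below : ∀ {a b e} → a < e → b < e → ∃[ m ] m < e × (∀ {s} → m < s → a < s × b < s)
  max-below {a} {b} a<e b<e with compare a b
  ... | tri< a<b _ _  = b , b<e , λ b<s → <-trans a<b b<s , b<s
  ... | tri≈ _ refl _ = a , a<e , λ a<s → a<s , a<s
  ... | tri> _ _ b<a  = a , a<e , λ a<s → a<s , <-trans b<a a<s

  min-above : ∀ {a b e} → e < a → e < b → ∃[ m ] e < m × (∀ {s} → s < m → s < a × s < b)
  min-above {a} {b} e<a e<b with compare a b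
  ... | tri< a<b _ _  = a , e<a , λ s<a → s<a , <-trans s<a a<b
  ... | tri≈ _ refl _ = a , e<a , λ s<a → s<a , s<a
  ... | tri> _ _ b<a  = b , e<b , λ s<b → <-trans s<b b<a , s<b

  -- The interval around `e` is shrunk past each element of `F` in turn. It starts as any interval
  -- around `e`, which exists because the order has no endpoints.
  gap : ∀ F e → ¬ e ∈ˡ F → ∃[ a ] ∃[ b ] (a < e × e < b) ×
        (∀ {s t} → a < s → t < b → Avoids F s t)
  gap [] e e∉ = let a , a<e = noMinimum e ; b , e<b = noMaximum e in
    a , b , (a<e , e<b) , λ _ _ ()
  gap (z ∷ F) e e∉ with gap F e (e∉ ∘ there) | compare z e
  ... | _ | tri≈ _ refl _ = contradiction (here refl) e∉
  ... | a , b , (a<e , e<b) , av | tri< z<e _ _ =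
    let m , m<e , above = max-below a<e z<e in m , b , (m<e , e<b) , λ where
      m<s t<b (here refl) → inj₁ (proj₂ (above m<s))
      m<s t<b (there e∈)  → av (proj₁ (above m<s)) t<b e∈
  ... | a , b , (a<e , e<b) , av | tri> _ _ e<z =
    let m , e<m , below = min-above e<b e<z in a , m , (a<e , e<m) , λ where
      a<s t<m (here refl) → inj₂ (proj₂ (below t<m))
      a<s t<m (there e∈)  → av a<s (proj₁ (below t<m)) e∈

  -- A point off the cut has a whole interval free of cut points around it, and `S` is constant
  -- there.
  boundary⊆cut : ∀ {S F} → CutBy S F → Boundary S ⊆ (_∈ˡ F)
  boundary⊆cut {S} {F} cutBy {e} bd = decidable-stable em λ e∉ →
    let a , b , nbhd , av = gap F e e∉ in
    bd (a , b , nbhd , λ s t ((a<s , s<b) , (a<t , t<b)) Ss → case s t (av a<s t<b) (av a<t s<b) Ss)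
    where
    case : ∀ s t → Avoids F s t → Avoids F t s → S s → S t
    case s t av av′ Ss with compare s t
    ... | tri< s<t _ _  = to (cutBy s<t av) Ss
    ... | tri≈ _ refl _ = Ss
    ... | tri> _ _ t<s  = from (cutBy t<s av′) Ss

  finite-boundary : {S : Vec C k → Pred C ℓ} → Def₁ S → ∀ b → Finite (Boundary (S b))
  finite-boundary s b = let F , cutBy = cut s b in F , boundary⊆cut cutBy

  -- Cut points at which S is locally constant can be discarded one at a time.
  constant-if-locally : ∀ F {S p q} → CutBy S F →
                        (∀ e → ¬ e < p → ¬ q < e → LocallyConstant S e) → p < q → S p ⇔ S q
  constant-if-locally F {S} {p} {q} cutBy loc p<q =
    go F (λ _ _ → cutBy) (<-irrefl refl) (<-irrefl refl) p<q λ ()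
    where
    CutBy′ : List C → Set ℓ
    CutBy′ F = ∀ {s t} → ¬ s < p → ¬ q < t → s < t → Avoids F s t → S s ⇔ S t

    drop-cut : ∀ {z F} → CutBy′ (z ∷ F) → CutBy′ F
    drop-cut {z} {F} cutBy {s} {t} p≤s t≤q s<t av with z <? s | t <? z
    ... | yes z<s | _       = cutBy p≤s t≤q s<t λ { (here refl) → inj₁ z<s ; (there e∈) → av e∈ }
    ... | _       | yes t<z = cutBy p≤s t≤q s<t λ { (here refl) → inj₂ t<z ; (there e∈) → av e∈ }
    -- Here `z` lies between `s` and `t`, so the passage from `s` to `t` is made through `z`, using
    -- that `S` is constant near it.
    ... | no s≤z  | no z≤t  with loc z (≮-trans p≤s s≤z) (≮-trans z≤t t≤q)
    ...   | a , b , (a<z , z<b) , const = ⇔-trans left right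
      where
      near : ∀ {u v} → (a < u × u < b) → (a < v × v < b) → S u ⇔ S v
      near u∈ v∈ = mk⇔ (const _ _ (u∈ , v∈)) (const _ _ (v∈ , u∈))

      left : S s ⇔ S z
      left with compare s z
      ... | tri≈ _ refl _ = ⇔-refl
      ... | tri> _ _ z<s  = contradiction z<s s≤z
      ... | tri< s<z _ _  =
        -- The point `u` is above `s` and so close to `z` that local constancy leads from `u` to
        -- `z`; the way from `s` to `u` no longer meets the cut point `z`.
        let m , m<z , above = max-below a<z s<z
            u , m<u , u<z   = dense m<z
            a<u , s<u       = above m<u
        in ⇔-trans
             (cutBy p≤s (≮-trans (<⇒≯ u<z) (≮-trans z≤t t≤q)) s<u λ where
               (here refl) → inj₂ u<z
               (there e∈)  → [ inj₁ , (λ t<e → inj₂ (<-trans (<-≮-trans u<z z≤t) t<e)) ]′ (av e∈))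
             (near (a<u , <-trans u<z z<b) (a<z , z<b))

      right : S z ⇔ S t
      right with compare z t
      ... | tri≈ _ refl _ = ⇔-refl
      ... | tri> _ _ t<z  = contradiction t<z z≤t
      ... | tri< z<t _ _  =
        let m , z<m , below = min-above z<b z<t
            u , z<u , u<m   = dense z<m
            u<b , u<t       = below u<m
        in ⇔-trans (near (a<z , z<b) (<-trans a<z z<u , u<b))
             (cutBy (≮-trans (≮-trans p≤s s≤z) (<⇒≯ z<u)) t≤q u<t λ where
               (here refl) → inj₁ z<u
               (there e∈)  → [ (λ e<s → inj₁ (<-trans e<s (≮-<-trans s≤z z<u))) , inj₂ ]′ (av e∈))

    go : ∀ F → CutBy′ F → CutBy′ []
    go []      cutBy = cutBy
    go (z ∷ F) cutBy = go F (drop-cut cutBy)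

-- Traces of a definable family on a countable set

pair : ℕ × ℕ → ℕ
pair (i , j) = (i + j) * (i + j) + i

-- With s = i + j, the code s² + i is at most s² + s, which is less than (s + 1)². Thus the code
-- determines s, and then i and j.
pair-mono : ∀ i j i′ j′ → i + j ℕ.< i′ + j′ → pair (i , j) ℕ.< pair (i′ , j′)
pair-mono i j i′ j′ s<s′ = begin-strict
  s * s + i        ≤⟨ ℕ.+-monoʳ-≤ (s * s) (ℕ.m≤m+n i j) ⟩
  s * s + s        <⟨ ℕ.n<1+n _ ⟩
  suc (s * s + s)  ≤⟨ s≤s (ℕ.≤-trans (ℕ.≤-reflexive (ℕ.+-comm (s * s) s)) (ℕ.m≤n+m _ s)) ⟩
  suc (s + (s + s * s))     ≡⟨ cong (λ u → suc (s + u)) (ℕ.*-suc s s) ⟨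
  suc s * suc s    ≤⟨ ℕ.*-mono-≤ s<s′ s<s′ ⟩
  s′ * s′          ≤⟨ ℕ.m≤m+n (s′ * s′) i′ ⟩
  s′ * s′ + i′     ∎
  where
  open ℕ.≤-Reasoning
  s = i + j
  s′ = i′ + j′

pair-injective : ∀ {p q} → pair p ≡ pair q → p ≡ q
pair-injective {i , j} {i′ , j′} eq with ℕ.<-cmp (i + j) (i′ + j′)
... | tri< s<s′ _ _ = contradiction (pair-mono i j i′ j′ s<s′) (ℕ.<-irrefl eq)
... | tri> _ _ s′<s = contradiction (pair-mono i′ j′ i j s′<s) (ℕ.<-irrefl (sym eq))
... | tri≈ _ s≡s′ _ with ℕ.+-cancelˡ-≡ ((i + j) * (i + j)) i i′
                          (trans eq (cong (λ s → s * s + i′) (sym s≡s′)))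
...   | refl = cong (i ,_) (ℕ.+-cancelˡ-≡ i j j′ s≡s′)

ℕ×ℕ↣ℕ : (ℕ × ℕ) ↣ ℕ
ℕ×ℕ↣ℕ = mk↣ pair-injective

ℕ⊎ℕ↣ℕ : (ℕ ⊎ ℕ) ↣ ℕ
ℕ⊎ℕ↣ℕ = ℕ×ℕ↣ℕ ↣-∘ mk↣ {to = tag} tag-injective
  where
  tag : ℕ ⊎ ℕ → ℕ × ℕ
  tag (inj₁ i) = 0 , i
  tag (inj₂ i) = 1 , i
  tag-injective : ∀ {p q} → tag p ≡ tag q → p ≡ q
  tag-injective {inj₁ _} {inj₁ _} refl = refl
  tag-injective {inj₂ _} {inj₂ _} refl = refl

module Traces (em : ∀ {a} → ExcludedMiddle a) {f r ℓ : Level} {L : Language f r}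
              (M : Structure L ℓ) (om : OMinimal M) where
  open Equivalence using (to; from)
  open Structure M renaming (Carrier to C)
  open OMinimal om
  open IsDenseLinearOrder isDenseLinearOrder using (compare; _<?_)
    renaming (trans to <-trans; irrefl to <-irrefl)
  open Definability M
  open Def₁ using (uncurried)
  open Tameness em M om

  -- At least i elements of F lie below c, expressed so as to be definable with F.
  below : Pred C ℓ → ℕ → Pred C ℓ
  below F zero    c = ⊤
  below F (suc i) c = ∃[ e ] e < c × F e × below F i e

  rank : Pred C ℓ → ℕ → Pred C ℓ
  rank F i c = below F i c × ¬ below F (suc i) c

  below-mono : ∀ {F c e} i → ¬ e < c → below F i c → below F i e
  below-mono zero    c≤e b                  = tt
  below-mono (suc i) c≤e (u , u<c , Fu , b) = u , <-≮-trans u<c c≤e , Fu , b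

  -- An element of `F` in this range, together with the `i` elements below `c`, would give `i + 1`
  -- elements below `c′`.
  rank-gap : ∀ {F i c c′} → rank F i c → rank F i c′ → ∀ {e} → ¬ e < c → e < c′ → ¬ F e
  rank-gap {i = i} (b , _) (_ , ¬b) c≤e e<c′ Fe = ¬b (_ , e<c′ , Fe , below-mono i c≤e b)

  -- Hence belonging to `F` with rank `i` defines at most one point: the element of `F` with exactly
  -- `i` predecessors in `F`.
  rank-unique : ∀ {F i c c′} → F c × rank F i c → F c′ × rank F i c′ → c ≡ c′
  rank-unique {c = c} {c′} (Fc , rc) (Fc′ , rc′) with compare c c′
  ... | tri< c<c′ _ _ = contradiction Fc (rank-gap rc rc′ (<-irrefl refl) c<c′)
  ... | tri≈ _ c≡c′ _ = c≡c′
  ... | tri> _ _ c′<c = contradiction Fc′ (rank-gap rc′ rc (<-irrefl refl) c′<c)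

  number-below : C → List C → ℕ
  number-below c = length ∘ filter (_<? c)

  number-below-mono : ∀ {c e} → e < c → ∀ zs → number-below e zs ℕ.≤ number-below c zs
  number-below-mono e<c [] = z≤n
  number-below-mono {c} {e} e<c (z ∷ zs) with z <? e | z <? c
  ... | yes _   | yes _  = s≤s (number-below-mono e<c zs)
  ... | yes z<e | no z≮c = contradiction (<-trans z<e e<c) z≮c
  ... | no _    | yes _  = ℕ.m≤n⇒m≤1+n (number-below-mono e<c zs)
  ... | no _    | no _   = number-below-mono e<c zs

  number-below-strict : ∀ {c e} → e < c → ∀ {zs} → e ∈ˡ zs → number-below e zs ℕ.< number-below c zs
  number-below-strict {c} {e} e<c {z ∷ zs} (here refl) with z <? e | z <? c
  ... | yes z<e | _      = contradiction z<e (<-irrefl refl)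
  ... | no _    | yes _  = s≤s (number-below-mono e<c zs)
  ... | no _    | no z≮c = contradiction e<c z≮c
  number-below-strict {c} {e} e<c {z ∷ zs} (there e∈) with z <? e | z <? c
  ... | yes _   | yes _  = s≤s (number-below-strict e<c e∈)
  ... | yes z<e | no z≮c = contradiction (<-trans z<e e<c) z≮c
  ... | no _    | yes _  = ℕ.m≤n⇒m≤1+n (number-below-strict e<c e∈)
  ... | no _    | no _   = number-below-strict e<c e∈

  below-bounded : ∀ {F zs} → F ⊆ (_∈ˡ zs) → ∀ i {c} → below F i c → i ℕ.≤ number-below c zs
  below-bounded F⊆ zero    _                  = z≤n
  below-bounded F⊆ (suc i) (e , e<c , Fe , b) =
    ℕ.≤-<-trans (below-bounded F⊆ i b) (number-below-strict e<c (F⊆ Fe))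

  rank-exists : ∀ {F} → Finite F → ∀ c → ∃[ i ] rank F i c
  rank-exists {F} (zs , F⊆) c =
    -- The list bounds how many elements of `F` lie below `c`; the search descends from one more
    -- than this bound, where `below` fails.
    search (suc (number-below c zs)) λ b → ℕ.<-irrefl refl (below-bounded F⊆ _ b)
    where
    search : ∀ m → ¬ below F m c → ∃[ i ] rank F i c
    search zero    ¬b = contradiction tt ¬b
    search (suc m) ¬b with em {P = below F m c}
    ... | yes b  = m , b , ¬b
    ... | no ¬b′ = search m ¬b′

  no-boundary⇒constant : {S : Vec C k → Pred C ℓ} → Def₁ S → ∀ b {p q} →
    (∀ e → ¬ e < p → ¬ q < e → ¬ Boundary (S b) e) → p < q → S b p ⇔ S b q
  no-boundary⇒constant s b ∄ = let F , cutBy = cut s b in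
    constant-if-locally F cutBy λ e p≤e e≤q → decidable-stable em (∄ e p≤e e≤q)

  private
    v₀ : Coordinate {suc n} head
    v₀ = head-coord
    ↑_ : {t : Vec C n → C} → Coordinate t → Coordinate {suc n} (t ∘ tail)
    ↑ t = t ∘ᵗ tail-coords

  def-boundary : {S : Vec C k → Pred C ℓ} → Def₁ S → Def₁ (λ b → Boundary (S b))
  def-boundary s = def₁ (def-¬ (def-∃ (def₁ (def-∃ (def₁ (def-×
    (def-× (def-< (↑ v₀) (↑ ↑ v₀)) (def-< (↑ ↑ v₀) v₀))
    (def-∀ (def₁ (def-∀ (def₁ (def-→
      -- The coordinates are now `t`, `s`, `b`, `a`, `e` of the definition of `Boundary`, innermost
      -- first, followed by the parameters.
      (def-× (def-× (def-< (↑ ↑ ↑ v₀) (↑ v₀)) (def-< (↑ v₀) (↑ ↑ v₀)))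
             (def-× (def-< (↑ ↑ ↑ v₀) v₀) (def-< v₀ (↑ ↑ v₀))))
      (def-→ (apply₁ s params (↑ v₀)) (apply₁ s params v₀)))))))))))))
    where params = tail-coords ∘ᶜ (tail-coords ∘ᶜ (tail-coords ∘ᶜ (tail-coords ∘ᶜ tail-coords)))

  def-below : {F : Vec C k → Pred C ℓ} → Def₁ F → ∀ i → Def₁ (λ b → below (F b) i)
  def-below d zero    = def₁ def-⊤
  def-below d (suc i) = def₁ (def-∃ (def₁ (def-× (def-< v₀ (↑ v₀))
    (def-× (apply₁ d (tail-coords ∘ᶜ tail-coords) v₀)
           (apply₁ (def-below d i) (tail-coords ∘ᶜ tail-coords) v₀)))))

  def-rank : {F : Vec C k → Pred C ℓ} → Def₁ F → ∀ i → Def₁ (λ b → rank (F b) i)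
  def-rank d i = def₁ (def-× (uncurried (def-below d i)) (def-¬ (uncurried (def-below d (suc i)))))

  -- Induction on the number of parameters

  module _ {A : Pred (Vec C n) ℓ} (A-def : Def A) (enum : [ v ∈ Vec C n ∣ A v ] ↣ ℕ) where

    -- Countability is expressed by a code in ℕ that determines the trace on `A`. Inclusion of
    -- traces suffices, since `b` and `b′` may be exchanged.
    CountablyManyTraces : (Vec C n → Pred (Vec C k) ℓ) → Set ℓ
    CountablyManyTraces {k} R = Σ[ code ∈ (Vec C k → ℕ) ]
      ∀ {b b′} → code b ≡ code b′ → ∀ {d} → A d → R d b → R d b′

    -- Within a cell the choice of `c` does not affect the trace, so it may be quantified out: the
    -- trace at `c ∷ b` equals that of `R′ j` at `b`, which has one parameter fewer. The code pairs
    -- the index of the cell with the code of `b` for `R′ j`.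
    by-cells : ∀ {j} {J : Set j} → J ↣ ℕ → {R : Vec C n → Pred (Vec C (suc k)) ℓ} → Def₂ R →
      (G : J → Vec C k → Pred C ℓ) → (∀ j → Def₁ (G j)) → (∀ b c → ∃[ j ] G j b c) →
      (∀ j {b c c′} → G j b c → G j b c′ → ∀ {d} → A d → R d (c ∷ b) → R d (c′ ∷ b)) →
      (∀ {R′ : Vec C n → Pred (Vec C k) ℓ} → Def₂ R′ → CountablyManyTraces R′) →
      CountablyManyTraces R
    by-cells {k} {J = J} J↣ℕ {R} R-def G G-def cell homogeneous ih =
      code , λ {b} {b′} → transfer {b} {b′}
      where
      R′ : J → Vec C n → Pred (Vec C k) ℓ
      R′ j d b = ∃[ c ] G j b c × R d (c ∷ b)

      traces : ∀ j → CountablyManyTraces (R′ j)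
      traces j = ih {R′ j} (def₂ (def-∃ (def₁ (def-×
        (apply₁ (G-def j) (drop-coords n ∘ᶜ tail-coords) head-coord)
        (apply₂ R-def (take-coords n ∘ᶜ tail-coords)
                      (head-coord ∷ᶜ (drop-coords n ∘ᶜ tail-coords)))))))

      code : Vec C (suc k) → ℕ
      code (c ∷ b) = let j , _ = cell b c in pair (Injection.to J↣ℕ j , proj₁ (traces j) b)

      transfer′ : ∀ {j j′ b b′ c c′} → j ≡ j′ → proj₁ (traces j) b ≡ proj₁ (traces j′) b′ →
                  G j b c → G j′ b′ c′ → ∀ {d} → A d → R d (c ∷ b) → R d (c′ ∷ b′)
      transfer′ {j} refl eq g g′ Ad Rd with proj₂ (traces j) eq Ad (_ , g , Rd)
      ... | _ , g″ , Rd″ = homogeneous j g″ g′ Ad Rd″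

      transfer : ∀ {b b′} → code b ≡ code b′ → ∀ {d} → A d → R d b → R d b′
      transfer {c ∷ b} {c′ ∷ b′} eq =
        transfer′ (Injection.injective J↣ℕ (cong proj₁ eqs)) (cong proj₂ eqs)
                  (proj₂ (cell b c)) (proj₂ (cell b′ c′))
        where eqs = pair-injective {_ , _} {_ , _} eq

    fibre : (Vec C n → Pred (Vec C (suc k)) ℓ) → Vec C n → Vec C k → Pred C ℓ
    fibre R d b c = R d (c ∷ b)

    def-fibre : {R : Vec C n → Pred (Vec C (suc k)) ℓ} → Def₂ R → ∀ d → Def₁ (fibre R d)
    def-fibre R-def d = def₁ (def-∘ (at₂ R-def d) (head-coord ∷ᶜ tail-coords))

    Changes : (Vec C n → Pred (Vec C (suc k)) ℓ) → Vec C k → Pred C ℓ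
    Changes R b e = ∃[ d ] A d × Boundary (fibre R d b) e

    -- Although `A` is countable, the union over its points is no infinite disjunction: `A` is
    -- definable, so it is a quantifier over tuples.
    def-changes : {R : Vec C n → Pred (Vec C (suc k)) ℓ} → Def₂ R → Def₁ (Changes R)
    def-changes {R = R} R-def =
      def₁ (def-∃* n {λ d w → A d × Boundary (fibre R d (tail w)) (head w)}
        (def₂ (def-× (def-∘ A-def (take-coords n)) boundary)))
      where
      boundary : Def (λ w → Boundary (fibre R (take n w) (tail (drop n w))) (head (drop n w)))
      boundary = def-⇔
        (λ w → ≡⇒ (cong₂ (λ d b → Boundary (fibre R d b) (head (drop n w)))
                         (take-++ (take n w) (tail (drop n w)))
                         (drop-++ (take n w) (tail (drop n w)))))
        -- The point `d` and the parameters `b` are joined into one tuple `u`, so that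
        -- `def-boundary` applies uniformly in `d`.
        (apply₁ {S = λ u → Boundary (fibre R (take n u) (drop n u))}
          (def-boundary (def₁ (apply₂ R-def (take-coords n ∘ᶜ tail-coords)
                                            (head-coord ∷ᶜ (drop-coords n ∘ᶜ tail-coords)))))
          (take-coords n ++ᶜ (tail-coords ∘ᶜ drop-coords n)) (head-coord ∘ᵗ drop-coords n))

    traces-step : {R : Vec C n → Pred (Vec C (suc k)) ℓ} → Def₂ R →
      (∀ {R′ : Vec C n → Pred (Vec C k) ℓ} → Def₂ R′ → CountablyManyTraces R′) →
      CountablyManyTraces R
    traces-step {k} {R} R-def = by-cells J↣ℕ R-def G G-def cell homogeneous
      where
      J = ([ v ∈ Vec C n ∣ A v ] × ℕ) ⊎ ℕ ⊎ ℕ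
      J↣ℕ : J ↣ ℕ
      J↣ℕ = ℕ⊎ℕ↣ℕ ↣-∘ ((ℕ×ℕ↣ℕ ↣-∘ (enum ×-↣ ↣-id ℕ)) ⊎-↣ ℕ⊎ℕ↣ℕ)

      E : Vec C k → Pred C ℓ
      E = Changes R

      E-def : Def₁ E
      E-def = def-changes R-def

      fibre-def : ∀ d → Def₁ (fibre R d)
      fibre-def = def-fibre R-def

      G : J → Vec C k → Pred C ℓ
      G (inj₁ ((d , _) , i)) b c = Boundary (fibre R d b) c × rank (Boundary (fibre R d b)) i c
      G (inj₂ (inj₁ i))      b c = Boundary (E b) c × rank (Boundary (E b)) i c
      G (inj₂ (inj₂ i))      b c = (¬ E b c × ¬ Boundary (E b) c) × rank (Boundary (E b)) i c

      G-def : ∀ j → Def₁ (G j)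
      G-def (inj₁ ((d , _) , i)) = def₁ (def-× (uncurried bd) (uncurried (def-rank bd i)))
        where bd = def-boundary (fibre-def d)
      G-def (inj₂ (inj₁ i))      = def₁ (def-× (uncurried bd) (uncurried (def-rank bd i)))
        where bd = def-boundary E-def
      G-def (inj₂ (inj₂ i))      = def₁ (def-×
        (def-× (def-¬ (uncurried E-def)) (def-¬ (uncurried bd))) (uncurried (def-rank bd i)))
        where bd = def-boundary E-def

      cell : ∀ b c → ∃[ j ] G j b c
      cell b c = locate em em
        where
        ranked : ∃[ i ] rank (Boundary (E b)) i c
        ranked = rank-exists (finite-boundary E-def b) c
        locate : Dec (E b c) → Dec (Boundary (E b) c) → ∃[ j ] G j b c
        locate (yes (d , Ad , bd)) _ =
          let i , rk = rank-exists (finite-boundary (fibre-def d) b) c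
          in inj₁ ((d , Irrelevant.[ Ad ]) , i) , bd , rk
        locate (no _)   (yes bd) = inj₂ (inj₁ (proj₁ ranked)) , bd , proj₂ ranked
        locate (no c∉E) (no ¬bd) = inj₂ (inj₂ (proj₁ ranked)) , (c∉E , ¬bd) , proj₂ ranked

      -- Equal ranks leave no boundary point of `E b` from `c` to `c′`, so `E b` is constant there,
      -- and empty because it omits `c`. Thus no fibre over a point of `A` has a boundary point
      -- there.
      constant : ∀ i {b c c′} → G (inj₂ (inj₂ i)) b c → G (inj₂ (inj₂ i)) b c′ → c < c′ →
                 ∀ {d} → A d → R d (c ∷ b) ⇔ R d (c′ ∷ b)
      constant i {b} {c} {c′} ((c∉E , _) , rc) ((_ , c′∉B) , rc′) c<c′ {d} Ad =
        no-boundary⇒constant (fibre-def d) b (λ e c≤e e≤c′ bd → ∉E e c≤e e≤c′ (d , Ad , bd)) c<c′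
        where
        ∉Boundary : ∀ e → ¬ e < c → ¬ c′ < e → ¬ Boundary (E b) e
        ∉Boundary e c≤e e≤c′ with compare e c′
        ... | tri< e<c′ _ _ = rank-gap rc rc′ c≤e e<c′
        ... | tri≈ _ refl _ = c′∉B
        ... | tri> _ _ c′<e = contradiction c′<e e≤c′
        ∉E : ∀ e → ¬ e < c → ¬ c′ < e → ¬ E b e
        ∉E e c≤e e≤c′ e∈E with compare c e
        ... | tri> _ _ e<c  = c≤e e<c
        ... | tri≈ _ refl _ = c∉E e∈E
        ... | tri< c<e _ _  = c∉E (from (no-boundary⇒constant E-def b
          (λ u c≤u u≤e → ∉Boundary u c≤u (≮-trans u≤e e≤c′)) c<e) e∈E)

      homogeneous : ∀ j {b c c′} → G j b c → G j b c′ → ∀ {d} → A d → R d (c ∷ b) → R d (c′ ∷ b)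
      homogeneous (inj₁ _)        g g′ _ Rd = subst (λ c → R _ (c ∷ _)) (rank-unique g g′) Rd
      homogeneous (inj₂ (inj₁ _)) g g′ _ Rd = subst (λ c → R _ (c ∷ _)) (rank-unique g g′) Rd
      homogeneous (inj₂ (inj₂ i)) {b} {c} {c′} g g′ Ad Rd with compare c c′
      ... | tri< c<c′ _ _ = to (constant i g g′ c<c′ Ad) Rd
      ... | tri≈ _ refl _ = Rd
      ... | tri> _ _ c′<c = from (constant i g′ g c′<c Ad) Rd

    countably-many-traces : ∀ k {R : Vec C n → Pred (Vec C k) ℓ} → Def₂ R → CountablyManyTraces R
    countably-many-traces zero    R-def = (λ _ → 0) , λ { {[]} {[]} _ _ Rd → Rd }
    countably-many-traces (suc k) R-def = traces-step R-def (countably-many-traces k)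

-- The four spaces

bounded : (f : X → ℕ) (zs : List X) → ∃[ m ] (∀ {z} → z ∈ˡ zs → f z ℕ.≤ m)
bounded f []       = 0 , λ ()
bounded f (z ∷ zs) = let m , ≤m = bounded f zs in f z + m , λ where
  (here refl) → ℕ.m≤m+n (f z) m
  (there z∈)  → ℕ.≤-trans (≤m z∈) (ℕ.m≤n+m m (f z))

beyond : {P : Pred ℕ ℓ} → Finite P → ∀ n → ∃[ m ] n ℕ.≤ m × m ∉ P
beyond (zs , P⊆) n = let b , ≤b = bounded id zs in
  suc (n + b) , ℕ.m≤n⇒m≤1+n (ℕ.m≤m+n n b) ,
  λ Pm → ℕ.<-irrefl refl (ℕ.≤-trans (s≤s (ℕ.m≤n+m b n)) (≤b (P⊆ Pm)))

p<q⇒0<q-p : ∀ {p q} → p ℚ.< q → 0ℚ ℚ.< q ℚ.- p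
p<q⇒0<q-p {p} {q} p<q = subst (ℚ._< q ℚ.- p) (ℚ.+-inverseʳ p) (ℚ.+-monoˡ-< (ℚ.- p) p<q)

p≤∣p∣ : ∀ p → p ℚ.≤ ℚ.∣ p ∣
p≤∣p∣ p with ℚ.≤-total 0ℚ p
... | inj₁ 0≤p = ℚ.≤-reflexive (sym (ℚ.0≤p⇒∣p∣≡p 0≤p))
... | inj₂ p≤0 = ℚ.≤-trans p≤0 (ℚ.0≤∣p∣ p)

∣p-q∣≡∣q-p∣ : ∀ p q → ℚ.∣ p ℚ.- q ∣ ≡ ℚ.∣ q ℚ.- p ∣
∣p-q∣≡∣q-p∣ p q = trans (sym (ℚ.∣-p∣≡∣p∣ (p ℚ.- q))) (cong ℚ.∣_∣ (⁻¹-anti-homo‿- p q))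
  where open AbelianGroupProperties ℚ.+-0-abelianGroup using (⁻¹-anti-homo‿-)

module Spaces (em : ∀ {a} → ExcludedMiddle a) where

  -- In each space, a neighbourhood is built which omits a point of every
  -- basic neighbourhood of the point ∞, x, ∞ or 1, respectively.

  arens-no-countable-basis : ∀ {B : ℕ → Pred ArensPoint ℓ} → ¬ IsBasis (arens ℓ) B
  arens-no-countable-basis {ℓ} {B} (B-open , refine) =
    let j , ∞∈ , B⊆V = refine {V = V} V-open {∞} tt in
    B⊆V {x₂ _ _} (proj₂ (proj₂ (pick j)) ∞∈) (lift (j , refl))
    where
    -- Because of `n ≤ m`, only the choices for `n ≤ m` can remove points `x₂ m l`. So finitely many
    -- are removed for each `m`, and `V` stays open.
    pick : ∀ n → ∃[ (m , l) ] n ℕ.≤ m × (∞ ∈ B n → x₂ m l ∈ B n)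
    pick n with em {P = ∞ ∈ B n}
    ... | no ∞∉  = (n , 0) , ℕ.≤-refl , λ ∞∈ → contradiction ∞∈ ∞∉
    ... | yes ∞∈ =
      let at∞ , at₁     = B-open n
          m , n≤m , ¬x₁∉ = beyond (at∞ ∞∈) n
          l , _ , ¬x₂∉   = beyond (at₁ m (decidable-stable em ¬x₁∉)) 0
      in (m , l) , n≤m , λ _ → decidable-stable em ¬x₂∉

    V : Pred ArensPoint ℓ
    V (x₂ m l) = ¬ Lift ℓ (∃[ n ] proj₁ (pick n) ≡ (m , l))
    V _        = ⊤

    V-open : V ∈ Topology.Open (arens ℓ)
    V-open = (λ _ → [] , λ ∉V → ⊥-elim (∉V tt)) , λ m _ →
      applyUpTo (proj₂ ∘ proj₁ ∘ pick) (suc m) , λ {l} ∉V → omitted m l (decidable-stable em ∉V)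
      where
      omitted : ∀ m l → Lift ℓ (∃[ n ] proj₁ (pick n) ≡ (m , l)) →
                l ∈ˡ applyUpTo (proj₂ ∘ proj₁ ∘ pick) (suc m)
      omitted m l (lift (n , refl)) = ∈-applyUpTo⁺ (proj₂ ∘ proj₁ ∘ pick) (s≤s (proj₁ (proj₂ (pick n))))

  -- The maximal compact topology

  maximalCompact-no-countable-basis : ∀ {B : ℕ → Pred MaximalCompactPoint ℓ} →
                                      ¬ IsBasis (maximalCompact ℓ) B
  maximalCompact-no-countable-basis {ℓ} {B} (B-open , refine) =
    let j , x∈ , B⊆V = refine {V = ∁ (AddPoint y P)} V-open {x} (λ ()) in
    B⊆V (proj₂ (pick j) x∈) (grid (lift refl))
    where
    -- The point for `B n` is taken in row `1+ n`, so the chosen points meet each row once and their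
    -- removal leaves a neighbourhood of `x`.
    pick : ∀ n → ∃[ m ] (x ∈ B n → pt (m , 1+ n) ∈ B n)
    pick n with em {P = x ∈ B n}
    ... | no x∉  = 1+ 0 , λ x∈ → contradiction x∈ x∉
    ... | yes x∈ =
      let P , finite , ⊆B = B-open n x x∈
          ms , row⊆       = finite (1+ n)
          m , _ , m∉      = beyond {P = λ m → (1+ m , 1+ n) ∈ P}
                              (map ℕ⁺.pred ms , ∈-map⁺ ℕ⁺.pred ∘ row⊆) 0
      in 1+ m , λ _ → ⊆B λ { (grid m∈) → m∉ m∈ }

    P : Pred (ℕ⁺ × ℕ⁺) ℓ
    P (m , 1+ n) = Lift ℓ (m ≡ proj₁ (pick n))

    V-open : ∁ (AddPoint y P) ∈ Topology.Open (maximalCompact ℓ)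
    V-open (pt _) ∈V = lift λ { refl → ∈V }
    V-open x      _  = P , (λ { (1+ n) → proj₁ (pick n) ∷ [] , λ { (lift refl) → here refl } }) , id
    V-open y      ∈V = ⊥-elim (∈V extra)

  -- The one-point compactification of the rationals

  enumerate : X ↣ ℕ → X → ∃[ e ] (∀ (z : X) → ∃[ n ] e n ≡ z)
  enumerate {X = X} code z₀ = (λ n → choose n em) , λ z → Injection.to code z , chosen z em
    where
    choose : ∀ n → Dec (∃[ z ] Injection.to code z ≡ n) → X
    choose n (yes (z , _)) = z
    choose n (no _)        = z₀
    chosen : ∀ z d → choose (Injection.to code z) d ≡ z
    chosen z (yes (z′ , eq)) = Injection.injective code eq
    chosen z (no ∄)          = contradiction (z , refl) ∄

  module _ (ℚ↣ℕ : ℚ ↣ ℕ) where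
    private
      e : ℕ → ℚ
      e = proj₁ (enumerate ℚ↣ℕ 0ℚ)

      e-surjective : ∀ q → ∃[ n ] e n ≡ q
      e-surjective = proj₂ (enumerate ℚ↣ℕ 0ℚ)

    Outside : ℚ × ℚ → Pred ℚ ℓ
    Outside {ℓ} (s , t) q = Lift ℓ (q ℚ.< s ⊎ t ℚ.< q)

    Outside-open : ∀ I → Outside I ∈ Topology.Open (euclideanℚ ℓ)
    Outside-open (s , t) q (lift (inj₁ q<s)) =
      s ℚ.- q , p<q⇒0<q-p q<s , λ {q′} near → lift $ inj₁ $ ℚ.≰⇒> λ s≤q′ →
        ℚ.<-irrefl refl (ℚ.≤-<-trans (ℚ.≤-trans (ℚ.+-monoˡ-≤ (ℚ.- q) s≤q′) (p≤∣p∣ (q′ ℚ.- q))) near)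
    Outside-open (s , t) q (lift (inj₂ t<q)) =
      q ℚ.- t , p<q⇒0<q-p t<q , λ {q′} near → lift $ inj₂ $ ℚ.≰⇒> λ q′≤t →
        ℚ.<-irrefl refl (ℚ.≤-<-trans
          (ℚ.≤-trans (ℚ.+-monoʳ-≤ q (ℚ.neg-antimono-≤ q′≤t)) (p≤∣p∣ (q ℚ.- q′)))
          (subst (ℚ._< q ℚ.- t) (∣p-q∣≡∣q-p∣ q′ q) near))

    Interval : Set
    Interval = Σ[ (s , t) ∈ ℚ × ℚ ] s ℚ.< t

    -- Two intermediate points m < m′ give disjoint closed subintervals [s, m] and [m′, t], and `r`
    -- misses at least one of them.
    shrink : ∀ r (((s , t) , _) : Interval) → Σ[ ((s′ , t′) , _) ∈ Interval ]
             s ℚ.≤ s′ × t′ ℚ.≤ t × (r ℚ.< s′ ⊎ t′ ℚ.< r)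
    shrink r ((s , t) , s<t) with ℚ.<-dense s<t
    ... | m , s<m , m<t with ℚ.<-dense m<t
    ...   | m′ , m<m′ , m′<t with r ℚ.<? m′
    ...     | yes r<m′ = ((m′ , t) , m′<t) , ℚ.<⇒≤ (ℚ.<-trans s<m m<m′) , ℚ.≤-refl , inj₁ r<m′
    ...     | no r≮m′  = ((s , m) , s<m) , ℚ.≤-refl , ℚ.<⇒≤ m<t ,
                         inj₂ (ℚ.<-≤-trans m<m′ (ℚ.≮⇒≥ r≮m′))

    module _ (I₀ : Interval) where
      nested : ℕ → Interval
      nested zero    = I₀
      nested (suc n) = proj₁ (shrink (e n) (nested n))

      nested-antitone : ∀ {m n} → m ℕ.≤′ n →
        proj₁ (proj₁ (nested m)) ℚ.≤ proj₁ (proj₁ (nested n)) ×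
        proj₂ (proj₁ (nested n)) ℚ.≤ proj₂ (proj₁ (nested m))
      nested-antitone ℕ.≤′-refl           = ℚ.≤-refl , ℚ.≤-refl
      nested-antitone (ℕ.≤′-step {n} m≤n) =
        let s≤ , ≤t            = nested-antitone m≤n
            _ , s≤′ , ≤t′ , _ = shrink (e n) (nested n)
        in ℚ.≤-trans s≤ s≤′ , ℚ.≤-trans ≤t′ ≤t

    -- No rational lies in all intervals of Cantor's nested sequence, so their
    -- exteriors cover ℚ, but no finitely many of them cover the first interval.
    compact-no-interior : ∀ {K : Pred ℚ ℓ} → Compact (euclideanℚ ℓ) K → ∀ {s t} → s ℚ.< t →
                          ∃[ q ] (s ℚ.< q × q ℚ.< t) × q ∉ K
    compact-no-interior {ℓ} {K} cK {s} {t} s<t with em {P = ∃[ q ] (s ℚ.< q × q ℚ.< t) × q ∉ K}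
    ... | yes found = found
    ... | no ∄      =
      let js , K⊆       = cK V (λ (lift n) → Outside-open (J n)) (λ {q} _ → cover q)
          -- The interval of index `m` lies inside all those indexed by the subcover, so a point `q`
          -- strictly inside it is in `K` but in none of the exteriors.
          m , ≤m        = bounded lower js
          (u , v) , u<v = nested I₀ m
          q , u<q , q<v = ℚ.<-dense u<v
          s≤u , v≤t     = nested-antitone I₀ (ℕ.≤⇒≤′ (z≤n {m}))
          s<q           = ℚ.≤-<-trans s≤u u<q
          q<t           = ℚ.<-≤-trans q<v v≤t
          lift j , j∈ , out = find (K⊆ (decidable-stable em λ q∉K → ∄ (q , (s<q , q<t) , q∉K)))
      in contradiction out (not-outside (ℕ.≤⇒≤′ (≤m j∈)) u<q q<v)
      where
      I₀ : Interval
      I₀ = (s , t) , s<t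
      J : ℕ → ℚ × ℚ
      J n = proj₁ (nested I₀ n)
      V : Lift ℓ ℕ → Pred ℚ ℓ
      V (lift n) = Outside (J n)
      cover : ∀ q → q ∈ ⋃ (Lift ℓ ℕ) V
      cover q with e-surjective q
      -- The index is `suc n` because `e n` is avoided in passing from stage `n` to the next.
      ... | n , refl = lift (suc n) , lift (proj₂ (proj₂ (proj₂ (shrink (e n) (nested I₀ n)))))
      not-outside : ∀ {j m q} → j ℕ.≤′ m → proj₁ (J m) ℚ.< q → q ℚ.< proj₂ (J m) →
                    q ∉ Outside {ℓ} (J j)
      not-outside j≤m u<q q<v (lift (inj₁ q<u)) = ℚ.<-irrefl refl
        (ℚ.<-trans q<u (ℚ.≤-<-trans (proj₁ (nested-antitone I₀ j≤m)) u<q))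
      not-outside j≤m u<q q<v (lift (inj₂ v<q)) = ℚ.<-irrefl refl
        (ℚ.<-trans v<q (ℚ.<-≤-trans q<v (proj₂ (nested-antitone I₀ j≤m))))

    private
      -- The default 1 for the other rationals keeps the minima in `ε` positive.
      positive-part : ℚ → Σ[ q ∈ ℚ ] 0ℚ ℚ.< q
      positive-part q with 0ℚ ℚ.<? q
      ... | yes 0<q = q , 0<q
      ... | no _    = 1ℚ , ℚ.positive⁻¹ 1ℚ

      positive-part-id : ∀ {q} → 0ℚ ℚ.< q → proj₁ (positive-part q) ≡ q
      positive-part-id {q} 0<q with 0ℚ ℚ.<? q
      ... | yes _  = refl
      ... | no ≮q = contradiction 0<q ≮q

      ⊓-positive : ∀ {p q} → 0ℚ ℚ.< p → 0ℚ ℚ.< q → 0ℚ ℚ.< p ℚ.⊓ q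
      ⊓-positive {p} {q} 0<p 0<q with ℚ.⊓-sel p q
      ... | inj₁ eq = subst (0ℚ ℚ.<_) (sym eq) 0<p
      ... | inj₂ eq = subst (0ℚ ℚ.<_) (sym eq) 0<q

      -- ε n is at most each positive rational among e 0, …, e (n - 1), so ε tends to 0.
      ε : ℕ → Σ[ q ∈ ℚ ] 0ℚ ℚ.< q
      ε zero    = 1ℚ , ℚ.positive⁻¹ 1ℚ
      ε (suc n) = proj₁ (ε n) ℚ.⊓ proj₁ (positive-part (e n)) ,
                  ⊓-positive (proj₂ (ε n)) (proj₂ (positive-part (e n)))

      ε-antitone : ∀ {m n} → m ℕ.≤′ n → proj₁ (ε n) ℚ.≤ proj₁ (ε m)
      ε-antitone ℕ.≤′-refl       = ℚ.≤-refl
      ε-antitone (ℕ.≤′-step m≤n) = ℚ.≤-trans (ℚ.p⊓q≤p _ _) (ε-antitone m≤n)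

      -- The number `δ` is itself some `e m`, so it takes part in the minimum from `ε (suc m)` on.
      ε-null : ∀ {δ} → 0ℚ ℚ.< δ → ∃[ m ] (∀ {n} → m ℕ.≤ n → proj₁ (ε n) ℚ.≤ δ)
      ε-null {δ} 0<δ with e-surjective δ
      ... | m , refl = suc m , λ m<n → ℚ.≤-trans (ε-antitone (ℕ.≤⇒≤′ m<n))
        (ℚ.≤-trans (ℚ.p⊓q≤q (proj₁ (ε m)) _) (ℚ.≤-reflexive (positive-part-id 0<δ)))

    ℚ∞-no-countable-basis : ∀ {B : ℕ → Pred (Maybe ℚ) ℓ} → ¬ IsBasis (ℚ∞ em ℓ) B
    ℚ∞-no-countable-basis {ℓ} {B} (B-open , refine) =
      let j , ∞∈ , B⊆V = refine {V = V} (inj₂ (tt , K , K-compact , id , id)) {nothing} tt in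
      B⊆V (proj₂ (proj₂ (pick j)) ∞∈) (lift (inj₂ (j , refl)))
      where
      -- A neighbourhood of infinity omits only a compact set of rationals, which cannot contain all
      -- of (0, ε n). The chosen points tend to 0, so together with 0 they form a compact set `K`.
      pick : ∀ n → ∃[ q ] (0ℚ ℚ.< q × q ℚ.< proj₁ (ε n)) × (nothing ∈ B n → just q ∈ B n)
      pick n with B-open n
      ... | inj₁ (∞∉ , _) =
        let q , 0<q , q<ε = ℚ.<-dense (proj₂ (ε n)) in q , (0<q , q<ε) , λ ∞∈ → contradiction ∞∈ ∞∉
      ... | inj₂ (_ , _ , cK , _ , ⊆B) =
        let q , q∈ , q∉K = compact-no-interior cK (proj₂ (ε n)) in q , q∈ , λ _ → ⊆B q∉K

      K : Pred ℚ ℓ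
      K q = Lift ℓ (q ≡ 0ℚ ⊎ ∃[ n ] q ≡ proj₁ (pick n))

      V : Pred (Maybe ℚ) ℓ
      V nothing  = ⊤
      V (just q) = q ∉ K

      K-compact : Compact (euclideanℚ ℓ) K
      -- The member of the cover at 0 contains a ball, hence all chosen points from index `m₀` on;
      -- one member for each earlier point completes the subcover.
      K-compact {I} W W-open cover = j₀ ∷ applyUpTo index m₀ , covered
        where
        j₀ : I
        j₀ = proj₁ (cover (lift (inj₁ refl)))
        index : ℕ → I
        index n = proj₁ (cover (lift (inj₂ (n , refl))))
        ball = W-open j₀ 0ℚ (proj₂ (cover (lift (inj₁ refl))))
        m₀ = proj₁ (ε-null (proj₁ (proj₂ ball)))
        near : ∀ n → m₀ ℕ.≤ n → proj₁ (pick n) ∈ W j₀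
        near n m₀≤n = let q , (0<q , q<ε) , _ = pick n in proj₂ (proj₂ ball)
          (subst (ℚ._< proj₁ ball) (sym (trans (cong ℚ.∣_∣ (ℚ.+-identityʳ q)) (ℚ.0≤p⇒∣p∣≡p (ℚ.<⇒≤ 0<q))))
                 (ℚ.<-≤-trans q<ε (proj₂ (ε-null (proj₁ (proj₂ ball))) m₀≤n)))
        covered : K ⊆ λ q → Any (λ j → q ∈ W j) (j₀ ∷ applyUpTo index m₀)
        covered (lift (inj₁ refl)) = here (proj₂ (cover (lift (inj₁ refl))))
        covered (lift (inj₂ (n , refl))) with n ℕ.<? m₀
        ... | yes n<m = there (Any.map (λ { refl → proj₂ (cover (lift (inj₂ (n , refl)))) })
                                       (∈-applyUpTo⁺ index n<m))
        ... | no n≮m  = here (near n (ℕ.≮⇒≥ n≮m))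

  -- The Appert space

  N-suc : ∀ {E : Pred ℕ⁺ ℓ} n →
          N em (suc n) E ≡ N em n E + length (filter (λ m → em {P = m ∈ E}) (1+ n ∷ []))
  N-suc {E = E} n = begin
    length (filter E? (applyUpTo 1+_ (suc n)))
      ≡⟨ cong (length ∘ filter E?) (applyUpTo-∷ʳ 1+_ n) ⟨
    length (filter E? (applyUpTo 1+_ n ++ˡ 1+ n ∷ []))
      ≡⟨ cong length (filter-++ E? (applyUpTo 1+_ n) _) ⟩
    length (filter E? (applyUpTo 1+_ n) ++ˡ filter E? (1+ n ∷ []))
      ≡⟨ length-++ (filter E? (applyUpTo 1+_ n)) ⟩
    N em n E + length (filter E? (1+ n ∷ []))
      ∎
    where
    open ≡-Reasoning
    E? : ∀ m → Dec (m ∈ E)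
    E? m = em

  N-accept : ∀ {E : Pred ℕ⁺ ℓ} n → 1+ n ∈ E → N em (suc n) E ≡ suc (N em n E)
  N-accept {E = E} n n∈ = trans (N-suc n) (trans
    (cong (λ zs → N em n E + length zs) (filter-accept (λ m → em {P = m ∈ E}) n∈))
    (ℕ.+-comm (N em n E) 1))

  N-reject : ∀ {E : Pred ℕ⁺ ℓ} n → 1+ n ∉ E → N em (suc n) E ≡ N em n E
  N-reject {E = E} n n∉ = trans (N-suc n) (trans
    (cong (λ zs → N em n E + length zs) (filter-reject (λ m → em {P = m ∈ E}) n∉))
    (ℕ.+-identityʳ (N em n E)))

  N≤ : ∀ {E : Pred ℕ⁺ ℓ} n → N em n E ℕ.≤ n
  N≤ {E = E} zero    = z≤n
  N≤ {E = E} (suc n) with em {P = 1+ n ∈ E}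
  ... | yes n∈ = ℕ.≤-trans (ℕ.≤-reflexive (N-accept {E = E} n n∈)) (s≤s (N≤ n))
  ... | no n∉  = ℕ.≤-trans (ℕ.≤-reflexive (N-reject {E = E} n n∉)) (ℕ.m≤n⇒m≤1+n (N≤ n))

  -- The distance of k/n from 1 is (n - k)/n; cross-multiplication turns density estimates into
  -- integer inequalities.
  near-1 : ∀ {k} n .{{_ : NonZero n}} → k ℕ.≤ n → ∀ p →
           ℚ.∣ ℤ.+ k ℚ./ n ℚ.- 1ℚ ∣ ℚ.< p ⇔ ℤ.+ (n ∸ k) ℤ.* ℚ.↧ p ℤ.< ℚ.↥ p ℤ.* ℤ.+ n
  near-1 {k} (suc n) k≤n p@record{} = mk⇔
    (λ d<p → ℚᵘ.drop-*<* (ℚᵘ.<-respˡ-≃ distance (ℚ.toℚᵘ-mono-< d<p)))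
    (λ lt → ℚ.toℚᵘ-cancel-< (ℚᵘ.<-respˡ-≃ (ℚᵘ.≃-sym distance) (ℚᵘ.*<* lt)))
    where
    frac = ℚᵘ.mkℚᵘ (ℤ.+ k) n
    distance : ℚ.toℚᵘ ℚ.∣ ℤ.+ k ℚ./ suc n ℚ.- 1ℚ ∣ ℚᵘ.≃ ℚᵘ.mkℚᵘ (ℤ.+ (suc n ∸ k)) n
    distance = begin
      ℚ.toℚᵘ ℚ.∣ ℤ.+ k ℚ./ suc n ℚ.- 1ℚ ∣
        ≈⟨ ℚ.toℚᵘ-homo-∣-∣ (ℤ.+ k ℚ./ suc n ℚ.- 1ℚ) ⟩
      ℚᵘ.∣ ℚ.toℚᵘ (ℤ.+ k ℚ./ suc n ℚ.- 1ℚ) ∣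
        ≈⟨ ℚᵘ.∣-∣-cong (ℚ.toℚᵘ-homo-+ (ℤ.+ k ℚ./ suc n) (ℚ.- 1ℚ)) ⟩
      ℚᵘ.∣ ℚ.toℚᵘ (ℤ.+ k ℚ./ suc n) ℚᵘ.- ℚᵘ.1ℚᵘ ∣
        ≈⟨ ℚᵘ.∣-∣-cong (ℚᵘ.+-congˡ (ℚᵘ.- ℚᵘ.1ℚᵘ) (ℚ.toℚᵘ-fromℚᵘ frac)) ⟩
      ℚᵘ.∣ frac ℚᵘ.- ℚᵘ.1ℚᵘ ∣
        ≡⟨ cong₂ (λ i d → ℚᵘ.mkℚᵘ (ℤ.+ ℤ.∣ i ∣) d) numerator (ℕ.*-identityʳ n) ⟩
      ℚᵘ.mkℚᵘ (ℤ.+ ℤ.∣ k ℤ.⊖ suc n ∣) n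
        ≡⟨ cong (λ i → ℚᵘ.mkℚᵘ (ℤ.+ i) n) (ℤ.∣⊖∣-≤ k≤n) ⟩
      ℚᵘ.mkℚᵘ (ℤ.+ (suc n ∸ k)) n
        ∎
      where
      open ℚᵘ.≃-Reasoning
      numerator : ℤ.+ k ℤ.* ℤ.1ℤ ℤ.+ ℤ.-1ℤ ℤ.* ℤ.+ suc n ≡ k ℤ.⊖ suc n
      numerator = cong₂ ℤ._+_ (ℤ.*-identityʳ (ℤ.+ k)) (ℤ.-1*i≡-i (ℤ.+ suc n))

  -- Without elements beyond `m`, the counts of `E` would be bounded by `m`, which contradicts
  -- density 1.
  appert-unbounded : ∀ {E : Pred ℕ⁺ ℓ} → E ∈ Topology.Open (appert em ℓ) → (1+ 0) ∈ E →
                     ∀ m → ∃[ n ] m ℕ.≤ n × 1+ n ∈ E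
  appert-unbounded (inj₁ 1∉E) 1∈E m = contradiction 1∈E 1∉E
  appert-unbounded {E = E} (inj₂ (_ , density)) _ m with em {P = ∃[ n ] m ℕ.≤ n × 1+ n ∈ E}
  ... | yes found = found
  ... | no ∄      = contradiction half-full (ℕ.≤⇒≯ (begin
    l + m        ≤⟨ ℕ.+-monoʳ-≤ l (ℕ.m≤n⇒m≤1+n (ℕ.m≤n+m m n₀)) ⟩
    l + l        ≡⟨ cong (l +_) (ℕ.+-identityʳ l) ⟨
    2 * l        ≡⟨ ℕ.*-comm 2 l ⟩
    l * 2        ≤⟨ ℕ.*-monoˡ-≤ 2 l≤ ⟩
    (l + m ∸ N em (l + m) E) * 2 ∎))
    where
    open ℕ.≤-Reasoning
    few : ∀ i → N em (i + m) E ℕ.≤ m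
    few zero    = N≤ m
    few (suc i) = ℕ.≤-trans
      (ℕ.≤-reflexive (N-reject {E = E} (i + m) λ n∈ → ∄ (i + m , ℕ.m≤n+m m i , n∈))) (few i)
    n₀ = proj₁ (density ½ (ℚ.positive⁻¹ ½))
    -- As `l` exceeds `m`, at least half of the numbers up to `l + m` are missing; the summand `n₀`
    -- brings `l + m` into the range of the limit.
    l = suc (n₀ + m)
    l≤ : l ℕ.≤ l + m ∸ N em (l + m) E
    l≤ = subst (ℕ._≤ l + m ∸ N em (l + m) E) (ℕ.m+n∸n≡m l m) (ℕ.∸-monoʳ-≤ (l + m) (few l))
    half-full : (l + m ∸ N em (l + m) E) * 2 ℕ.< l + m
    half-full = ℤ.drop‿+<+ (subst₂ ℤ._<_
      (sym (ℤ.pos-* (l + m ∸ N em (l + m) E) 2)) (ℤ.*-identityˡ (ℤ.+ (l + m)))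
      (Equivalence.to (near-1 (l + m) (N≤ {E = E} (l + m)) ½)
        (proj₂ (density ½ (ℚ.positive⁻¹ ½)) (l + m)
          (ℕ.m≤n⇒m≤1+n (ℕ.≤-trans (ℕ.m≤m+n n₀ m) (ℕ.m≤m+n (n₀ + m) m))))))

  -- At most √n of the numbers up to n are missing from `E`, and √n / n tends to 0.
  appert-sparse : ∀ {E : Pred ℕ⁺ ℓ} → (1+ 0) ∈ E →
    (∀ n → ∃[ i ] n ℕ.≤ i + N em n E × i * i ℕ.≤ n) → E ∈ Topology.Open (appert em ℓ)
  appert-sparse {E = E} 1∈E omitted = inj₂ (1∈E , density)
    where
    density : (λ n → ℤ.+ N em n E ℚ./ n) ⟶ 1ℚ
    density (ℚ.mkℚ (ℤ.+ 0) _ _)        (ℚ.*<* (ℤ.+<+ ()))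
    density (ℚ.mkℚ ℤ.-[1+ _ ] _ _)     (ℚ.*<* ())
    -- The denominator of `p` is `suc d`. For n > (d + 1)² one has i(d + 1) < n: either i ≤ d + 1,
    -- or i(d + 1) < i² ≤ n.
    density p@(ℚ.mkℚ (ℤ.+ suc c) d _) 0<p = suc (suc d * suc d) , λ n n₀≤n →
      Equivalence.from (near-1 n (N≤ {E = E} n) p)
        (subst₂ ℤ._<_ (ℤ.pos-* (n ∸ N em n E) (suc d)) (ℤ.pos-* (suc c) n) (ℤ.+<+ (bound n n₀≤n)))
      where
      bound : ∀ n → suc d * suc d ℕ.< n → (n ∸ N em n E) * suc d ℕ.< suc c * n
      bound n d²<n with omitted n
      ... | i , n≤ , i²≤n = begin-strict
        (n ∸ N em n E) * suc d  ≤⟨ ℕ.*-monoˡ-≤ (suc d) (ℕ.m≤n+o⇒m∸n≤o n (N em n E)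
                                     (ℕ.≤-trans n≤ (ℕ.≤-reflexive (ℕ.+-comm i _)))) ⟩
        i * suc d               <⟨ i*d<n ⟩
        n                       ≤⟨ ℕ.m≤m+n n (c * n) ⟩
        suc c * n               ∎
        where
        open ℕ.≤-Reasoning
        i*d<n : i * suc d ℕ.< n
        i*d<n with i ℕ.≤? suc d
        ... | yes i≤d = ℕ.≤-<-trans (ℕ.*-monoˡ-≤ (suc d) i≤d) d²<n
        ... | no i≰d  = ℕ.<-≤-trans
          (ℕ.*-monoʳ-< i {{ℕ.>-nonZero (ℕ.≤-<-trans z≤n (ℕ.≰⇒> i≰d))}} (ℕ.≰⇒> i≰d)) i²≤n

  appert-no-countable-basis : ∀ {B : ℕ → Pred ℕ⁺ ℓ} → ¬ IsBasis (appert em ℓ) B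
  appert-no-countable-basis {ℓ} {B} (B-open , refine) =
    let j , 1∈ , B⊆V = refine {V} V-open 1∈V in B⊆V (a∈B j 1∈) (lift (j , refl))
    where
    pick : ∀ n m → ∃[ k ] m ℕ.≤ k × ((1+ 0) ∈ B n → 1+ k ∈ B n)
    pick n m with em {P = (1+ 0) ∈ B n}
    ... | no 1∉  = m , ℕ.≤-refl , λ 1∈ → contradiction 1∈ 1∉
    ... | yes 1∈ = let k , m≤k , k∈ = appert-unbounded (B-open n) 1∈ m in k , m≤k , λ _ → k∈

    -- The removed point `1+ a i` lies beyond (i + 1)², so the removed points are sparse. Starting
    -- from the bound 1 keeps the point `1+ 0` in `V`, and the summand `suc (a i)` makes `a`
    -- strictly increasing.
    a : ℕ → ℕ
    a zero    = proj₁ (pick 0 1)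
    a (suc i) = proj₁ (pick (suc i) (suc (a i) + suc (suc i) * suc (suc i)))

    a∈B : ∀ i → (1+ 0) ∈ B i → 1+ a i ∈ B i
    a∈B zero    = proj₂ (proj₂ (pick 0 1))
    a∈B (suc i) = proj₂ (proj₂ (pick (suc i) _))

    i²≤a : ∀ i → suc i * suc i ℕ.≤ a i
    i²≤a zero    = proj₁ (proj₂ (pick 0 1))
    i²≤a (suc i) = ℕ.≤-trans (ℕ.m≤n+m _ (suc (a i))) (proj₁ (proj₂ (pick (suc i) _)))

    a-step : ∀ i → a i ℕ.< a (suc i)
    a-step i = ℕ.≤-trans (ℕ.m≤m+n (suc (a i)) _) (proj₁ (proj₂ (pick (suc i) _)))

    a-mono : ∀ {i j} → i ℕ.≤′ j → a i ℕ.≤ a j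
    a-mono ℕ.≤′-refl           = ℕ.≤-refl
    a-mono (ℕ.≤′-step {j} i≤j) = ℕ.≤-trans (a-mono i≤j) (ℕ.<⇒≤ (a-step j))

    V : Pred ℕ⁺ ℓ
    V z = ¬ Lift ℓ (∃[ i ] z ≡ 1+ a i)

    1∈V : (1+ 0) ∈ V
    1∈V (lift (i , eq)) = ℕ.<-irrefl (cong ℕ⁺.pred eq) (ℕ.≤-trans (s≤s z≤n) (i²≤a i))

    -- Here `i` counts the removed points up to `n`. The last two conditions carry the induction:
    -- `1+ a j` is at most `n` exactly when `j < i`.
    omitted : ∀ n → ∃[ i ] n ℕ.≤ i + N em n V × i * i ℕ.≤ n ×
              (∀ j → j ℕ.< i → a j ℕ.< n) × n ℕ.≤ a i
    omitted zero    = 0 , z≤n , z≤n , (λ _ ()) , z≤n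
    omitted (suc n) with omitted n
    ... | i , n≤ , i²≤n , a< , n≤a with n ℕ.≟ a i
    ...   | yes refl = suc i ,
            s≤s (subst (λ k → n ℕ.≤ i + k) (sym (N-reject {E = V} n λ ∈V → ∈V (lift (i , refl)))) n≤) ,
            ℕ.m≤n⇒m≤1+n (i²≤a i) , (λ { j (s≤s j≤i) → s≤s (a-mono (ℕ.≤⇒≤′ j≤i)) }) , a-step i
    ...   | no n≢a   = i ,
            subst (suc n ℕ.≤_) (trans (sym (ℕ.+-suc i _)) (cong (i +_) (sym (N-accept {E = V} n n∈V))))
                  (s≤s n≤) ,
            ℕ.m≤n⇒m≤1+n i²≤n , (λ j j<i → ℕ.m≤n⇒m≤1+n (a< j j<i)) , ℕ.≤∧≢⇒< n≤a n≢a
      where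
      n∈V : 1+ n ∈ V
      n∈V (lift (j , refl)) with j ℕ.<? i
      ... | yes j<i = ℕ.<-irrefl refl (a< j j<i)
      ... | no j≮i  = n≢a (ℕ.≤-antisym n≤a (a-mono (ℕ.≤⇒≤′ (ℕ.≮⇒≥ j≮i))))

    V-open : V ∈ Topology.Open (appert em ℓ)
    V-open = appert-sparse 1∈V λ n → let i , n≤ , i²≤n , _ = omitted n in i , n≤ , i²≤n

-- Countability of the four point sets

ℤ↣ℕ : ℤ.ℤ ↣ ℕ
ℤ↣ℕ = ℕ⊎ℕ↣ℕ ↣-∘ mk↣ {to = split} injective
  where
  split : ℤ.ℤ → ℕ ⊎ ℕ
  split (ℤ.+ n)    = inj₁ n
  split ℤ.-[1+ n ] = inj₂ n
  injective : ∀ {i j} → split i ≡ split j → i ≡ j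
  injective {ℤ.+ _}      {ℤ.+ _}      refl = refl
  injective {ℤ.-[1+ _ ]} {ℤ.-[1+ _ ]} refl = refl

ℚ↣ℕ : ℚ ↣ ℕ
ℚ↣ℕ = (ℕ×ℕ↣ℕ ↣-∘ (ℤ↣ℕ ×-↣ ↣-id ℕ)) ↣-∘ mk↣ {to = fraction} injective
  where
  fraction : ℚ → ℤ.ℤ × ℕ
  fraction (mkℚ n d _) = n , d
  injective : ∀ {p q} → fraction p ≡ fraction q → p ≡ q
  injective {mkℚ _ _ _} {mkℚ _ _ _} refl = refl

Maybeℚ↣ℕ : Maybe ℚ ↣ ℕ
Maybeℚ↣ℕ = (ℕ⊎ℕ↣ℕ ↣-∘ (↣-id ℕ ⊎-↣ ℚ↣ℕ)) ↣-∘ mk↣ {to = split} injective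
  where
  split : Maybe ℚ → ℕ ⊎ ℚ
  split nothing  = inj₁ 0
  split (just q) = inj₂ q
  injective : ∀ {p q} → split p ≡ split q → p ≡ q
  injective {nothing} {nothing} _    = refl
  injective {just _}  {just _}  refl = refl

ArensPoint↣ℕ : ArensPoint ↣ ℕ
ArensPoint↣ℕ = (ℕ⊎ℕ↣ℕ ↣-∘ (ℕ⊎ℕ↣ℕ ⊎-↣ ℕ×ℕ↣ℕ)) ↣-∘ mk↣ {to = split} injective
  where
  split : ArensPoint → (ℕ ⊎ ℕ) ⊎ ℕ × ℕ
  split ∞        = inj₁ (inj₁ 0)
  split (x₁ n)   = inj₁ (inj₂ n)
  split (x₂ n m) = inj₂ (n , m)
  injective : ∀ {p q} → split p ≡ split q → p ≡ q
  injective {∞}      {∞}      _    = refl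
  injective {x₁ _}   {x₁ _}   refl = refl
  injective {x₂ _ _} {x₂ _ _} refl = refl

MaximalCompactPoint↣ℕ : MaximalCompactPoint ↣ ℕ
MaximalCompactPoint↣ℕ = (ℕ⊎ℕ↣ℕ ↣-∘ (↣-id ℕ ⊎-↣ ℕ×ℕ↣ℕ)) ↣-∘ mk↣ {to = split} injective
  where
  split : MaximalCompactPoint → ℕ ⊎ ℕ × ℕ
  split x                    = inj₁ 0
  split y                    = inj₁ 1
  split (pt (1+ m , 1+ n)) = inj₂ (m , n)
  injective : ∀ {p q} → split p ≡ split q → p ≡ q
  injective {x}    {x}    _    = refl
  injective {y}    {y}    _    = refl
  injective {pt _} {pt _} refl = refl

ℕ⁺↣ℕ : ℕ⁺ ↣ ℕ
ℕ⁺↣ℕ = mk↣ {to = ℕ⁺.pred} λ { refl → refl }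

-- Countable definable spaces

module _ (em : ∀ {a} → ExcludedMiddle a) {f r ℓ o : Level} {L : Language f r} {M : Structure L ℓ}
         (om : OMinimal M) {n : ℕ} {A : Pred (Vec (Structure.Carrier M) n) ℓ}
         {τ : Topology [ v ∈ Vec (Structure.Carrier M) n ∣ A v ] ℓ o}
         (definable : IsDefinableSpace M A τ) where
  open Structure M renaming (Carrier to C)
  open IsDefinableSpace definable renaming (k to l)
  open Definability M using (def; def₂; def-formula; def-⇔)
  open Traces em M om using (countably-many-traces)

  -- The basic open sets are traces of a definable family on `A`. One parameter in `B` is chosen for
  -- each code that occurs there, and it yields the same basic set as any other with that code.
  countable⇒countable-basis : [ v ∈ Vec C n ∣ A v ] ↣ ℕ →
    Σ[ V ∈ (ℕ → Pred [ v ∈ Vec C n ∣ A v ] ℓ) ] IsBasis τ V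
  countable⇒countable-basis enum = V , (λ i → V-open i em) , V-refine
    where
    traces = countably-many-traces (def A-definable) enum l {λ d b → M ⊨ φ [ d ++ b ]}
      (def₂ (def-⇔ (λ w → ≡⇒ (cong (M ⊨ φ [_]) (sym (take++drop≡id n w)))) (def-formula φ)))
    code = proj₁ traces

    HasCode : ℕ → Set ℓ
    HasCode i = Σ[ (b , _) ∈ (Σ[ b ∈ Vec C l ] b ∈ B) ] code b ≡ i

    V′ : ∀ i → Dec (HasCode i) → Pred [ v ∈ Vec C n ∣ A v ] ℓ
    V′ i (yes ((b , _) , _)) v = M ⊨ φ [ value v ++ b ]
    -- Codes that do not occur index the whole space, which is open.
    V′ i (no _)              = λ _ → ⊤

    V : ℕ → Pred [ v ∈ Vec C n ∣ A v ] ℓ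
    V i = V′ i em

    V-open : ∀ i d → V′ i d ∈ Topology.Open τ
    V-open i (yes (b , _)) = proj₁ isBasis b
    V-open i (no _)        = Topology.U-open τ

    same : ∀ (b : Σ[ b ∈ Vec C l ] b ∈ B) d {v} →
           (V′ (code (proj₁ b)) d v → M ⊨ φ [ value v ++ proj₁ b ]) ×
           (M ⊨ φ [ value v ++ proj₁ b ] → V′ (code (proj₁ b)) d v)
    same b (no ∄) = contradiction (b , refl) ∄
    same b (yes ((b′ , _) , eq)) {v} = proj₂ traces eq Av , proj₂ traces (sym eq) Av
      where
      Av : A (value v)
      Av with proof v
      -- Membership in `A` is stored irrelevantly; excluded middle recovers a usable proof.
      ... | Irrelevant.[ v∈A ] = recompute em v∈A

    V-refine : ∀ {W} → W ∈ Topology.Open τ → ∀ {v} → v ∈ W → ∃[ i ] v ∈ V i × V i ⊆ W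
    V-refine W-open v∈W with proj₂ isBasis W-open v∈W
    ... | b , v∈ , ⊆W = code (proj₁ b) , proj₂ (same b em) v∈ , λ u∈ → ⊆W (proj₁ (same b em) u∈)

  -- A homeomorphism makes the definable space countable, and its countable basis pulls back along
  -- `from` to one of `σ`.
  not-homeomorphic : ∀ {p o′} {Y : Set p} {σ : Topology Y ℓ o′} → Y ↣ ℕ →
    (∀ {V : ℕ → Pred Y ℓ} → ¬ IsBasis σ V) → ¬ (τ ≃ₜ σ)
  not-homeomorphic {σ = σ} enum no-basis h = no-basis {λ i → from ⊢ V i}
    ((λ i → from-continuous (V-open i)) , λ {W} W-open {z} z∈W →
      let i , z∈ , V⊆ = refine (to-continuous W-open) {from z} (subst W (sym (strictlyInverseˡ z)) z∈W)
      in i , z∈ , λ {u} u∈ → subst W (strictlyInverseˡ u) (V⊆ u∈))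
    where
    open _≃ₜ_ h
    open Inverse bijection using (from; strictlyInverseˡ)
    basis = countable⇒countable-basis (enum ↣-∘ Inverse⇒Injection bijection)
    V = proj₁ basis
    V-open = proj₁ (proj₂ basis)
    refine = proj₂ (proj₂ basis)

corollary3 : (em : ∀ {a} → ExcludedMiddle a) →
    {f r ℓ o : Level} {L : Language f r} (M : Structure L ℓ) → OMinimal M →
    (n : ℕ) (A : Pred (Vec (Structure.Carrier M) n) ℓ) →
    (τ : Topology [ v ∈ Vec (Structure.Carrier M) n ∣ A v ] ℓ o) →
    IsDefinableSpace M A τ →
    (¬ (τ ≃ₜ arens ℓ)) ×
    (¬ (τ ≃ₜ maximalCompact ℓ)) ×
    (¬ (τ ≃ₜ ℚ∞ em ℓ)) ×
    (¬ (τ ≃ₜ appert em ℓ))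
corollary3 em M om n A τ definable =
  not-homeomorphic em om definable ArensPoint↣ℕ arens-no-countable-basis ,
  not-homeomorphic em om definable MaximalCompactPoint↣ℕ maximalCompact-no-countable-basis ,
  not-homeomorphic em om definable Maybeℚ↣ℕ (ℚ∞-no-countable-basis ℚ↣ℕ) ,
  not-homeomorphic em om definable ℕ⁺↣ℕ appert-no-countable-basis
  where open Spaces em
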